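{- Let $G$ be a strongly connected graph such that $M(G)$ is a cycle of bunches, and let $q = \mathrm{per}(G)/\mathrm{per}(M(G))$. Then $O_{M(G),q} \leq_S G$.
   Context: All graphs are finite directed graphs $G$ consisting of a finite set $V(G)$ of states, a finite set $E(G)$ of edges and maps $s,t:E(G)\to V(G)$ (source and target); loops and parallel edges are allowed, and all graphs are assumed sink-free (every state has an outgoing edge). Write $E_I(G)=s^{ -1}(I)$, $F(I)=t(E_I(G))$ (followers of $I$), $L(G)$ for the set of finite edge paths $e_1\cdots e_n$ with $t(e_i)=s(e_{i+1})$, and $L_I(G)$ for the paths starting at $I$; $s,t$ extend to paths. A graph homomorphism $\Phi:G\to H$ is a pair of maps $\Phi:E(G)\to E(H)$, $\partial\Phi:V(G)\to V(H)$ with $s\circ\Phi=\partial\Phi\circ s$, $t\circ\Phi=\partial\Phi\circ t$; it induces a map on paths. Graphs are identified up to isomorphism. A right-resolver $\Phi:G\to H$ is a surjective homomorphism such that for every $I\in V(G)$, $\Phi|_{E_I(G)}$ is a bijection onto $E_{\partial\Phi(I)}(H)$; write $\hom_R(G,H)$ for the set of these and $H\leq_R G$ if it is nonempty ($\leq_R$ is a partial order). For every graph $G$ there is a unique $\leq_R$-minimal graph $M(G)$ with $M(G)\leq_R G$. For $\Phi\in\hom_R(G,H)$, $I\in V(G)$ and $u\in L_{\partial\Phi(I)}(H)$, $I\cdot u$ denotes the terminal state of the unique $\gamma\in L_I(G)$ with $\Phi(\gamma)=u$. The stability relation $\sim_\Phi$ on $V(G)$: $I_1\sim_\Phi I_2$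 iff $\partial\Phi(I_1)=\partial\Phi(I_2)=:I$ and for every $u\in L_I(H)$ there exists $v\in L_{t(u)}(H)$ with $I_1\cdot uv=I_2\cdot uv$. $\Phi$ is a synchronizer if each fiber $(\partial\Phi)^{ -1}(I)$, $I\in V(H)$, is a single $\sim_\Phi$ class; $H\leq_S G$ means there is a synchronizing right-resolver $G\to H$. A graph is strongly connected if there is a path from any state to any state; its period $\mathrm{per}(G)$ is the gcd of its cycle lengths. A cycle of bunches is a strongly connected graph in which every state $I$ has $|F(I)|=1$. If $M$ is a $\leq_R$-minimal cycle of bunches with states $I_0,\dots,I_{p-1}$, $F(I_i)=\{I_{i+1}\}$ (indices mod $p$) and out-degrees $D_i=|E_{I_i}(M)|$, then $O_{M,q}$ denotes the cycle of bunches of length $pq$ whose sequence of out-degrees is $D_0,\dots,D_{p-1}$ repeated cyclically $q$ times. -}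

module Defs where

open import Data.Nat using (ℕ; zero; suc; _*_; _≤_; _<_)
open import Data.Nat.Divisibility using (_∣_)
open import Data.Fin using (Fin; zero; suc; toℕ; fromℕ<; lower₁; _≟_)
open import Data.List using (List; []; _∷_; _++_; length)
open import Data.Product using (Σ; ∃; ∃!; _×_; _,_; proj₁; proj₂)
open import Data.Unit using (⊤)
open import Relation.Nullary using (yes; no)
open import Relation.Binary.PropositionalEquality using (_≡_; refl)

-- Finite sink-free directed graphs (loops / parallel edges allowed).
-- Up to isomorphism, a finite graph is given by its states Fin nV, the
-- out-degree of every state, and for each state v the targets of its
-- deg v outgoing edges.  The edge set is E(G) = Σ v. Fin (deg v),
-- s(v , k) = v and t(v , k) = tgt v k.

record Graph : Set where
  field
    nV       : ℕ
    deg      : Fin nV → ℕ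
    tgt      : (v : Fin nV) → Fin (deg v) → Fin nV
    sinkFree : (v : Fin nV) → 1 ≤ deg v
open Graph public

V : Graph → Set
V G = Fin (nV G)

E : Graph → Set
E G = Σ (V G) (λ v → Fin (deg G v))

src : (G : Graph) → E G → V G
src G e = proj₁ e

trg : (G : Graph) → E G → V G
trg G e = tgt G (proj₁ e) (proj₂ e)

IsPathFrom : (G : Graph) → V G → List (E G) → Set
IsPathFrom G I []       = ⊤
IsPathFrom G I (e ∷ es) = src G e ≡ I × IsPathFrom G (trg G e) es

end : (G : Graph) → V G → List (E G) → V G
end G I []       = I
end G I (e ∷ es) = end G (trg G e) es

record Hom (G H : Graph) : Set where
  field
    vmap     : V G → V H
    emap     : E G → E H
    src-comm : ∀ e → src H (emap e) ≡ vmap (src G e)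
    trg-comm : ∀ e → trg H (emap e) ≡ vmap (trg G e)
open Hom public

Bij : {A B : Set} → (A → B) → Set
Bij {A} {B} f = (∀ x y → f x ≡ f y → x ≡ y) × (∀ y → ∃ λ x → f x ≡ y)

record Iso (G H : Graph) : Set where
  field
    hom     : Hom G H
    vmapBij : Bij (vmap hom)
    emapBij : Bij (emap hom)

record RightResolver (G H : Graph) : Set where
  field
    hom       : Hom G H
    emap-surj : ∀ f → ∃ λ e → emap hom e ≡ f
    vmap-surj : ∀ J → ∃ λ I → vmap hom I ≡ J
    local-bij : ∀ (I : V G) (f : Fin (deg H (vmap hom I))) →
                ∃! _≡_ (λ (k : Fin (deg G I)) → emap hom (I , k) ≡ (vmap hom I , f))
open RightResolver public

_≤R_ : Graph → Graph → Set
H ≤R G = RightResolver G H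

IsRMinimal : Graph → Set
IsRMinimal M = ∀ H → H ≤R M → Iso H M

-- I · u : terminal state of the unique lift of u starting at I
-- (only meaningful when u ∈ L_{∂Φ(I)}(H); junk value otherwise)

dot : {G H : Graph} → RightResolver G H → V G → List (E H) → V G
dot R I [] = I
dot {G} R I ((J , k) ∷ fs) with J ≟ vmap (hom R) I
... | yes refl = dot R (tgt G I (proj₁ (local-bij R I k))) fs
... | no _     = I

Stable : {G H : Graph} → RightResolver G H → V G → V G → Set
Stable {G} {H} R I₁ I₂ =
  vmap (hom R) I₁ ≡ vmap (hom R) I₂ ×
  (∀ (u : List (E H)) → IsPathFrom H (vmap (hom R) I₁) u →
     ∃ λ (v : List (E H)) → IsPathFrom H (end H (vmap (hom R) I₁) u) v ×
       dot R I₁ (u ++ v) ≡ dot R I₂ (u ++ v))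

-- every fiber is a single ∼_Φ class (fibers are nonempty by surjectivity)
IsSynchronizer : {G H : Graph} → RightResolver G H → Set
IsSynchronizer {G} {H} R =
  ∀ (J : V H) (I₁ I₂ : V G) → vmap (hom R) I₁ ≡ J → vmap (hom R) I₂ ≡ J → Stable R I₁ I₂

_≤S_ : Graph → Graph → Set
H ≤S G = Σ (RightResolver G H) IsSynchronizer

StronglyConnected : Graph → Set
StronglyConnected G =
  ∀ (I J : V G) → ∃ λ γ → IsPathFrom G I γ × end G I γ ≡ J

IsCycle : (G : Graph) → V G → List (E G) → Set
IsCycle G I γ = IsPathFrom G I γ × end G I γ ≡ I × 1 ≤ length γ

IsPeriod : Graph → ℕ → Set
IsPeriod G d =
  (∀ I γ → IsCycle G I γ → d ∣ length γ) ×
  (∀ d′ → (∀ I γ → IsCycle G I γ → d′ ∣ length γ) → d′ ∣ d)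

-- strongly connected and |F(I)| = 1 for every state
-- (F(I) is nonempty by sink-freeness, so |F(I)| = 1 iff all edges out of I share a target)
CycleOfBunches : Graph → Set
CycleOfBunches G =
  StronglyConnected G × (∀ (I : V G) (a b : Fin (deg G I)) → tgt G I a ≡ tgt G I b)

-- a follower of I (the unique one in a cycle of bunches)
follower : (G : Graph) → V G → V G
follower G I = tgt G I (fromℕ< (sinkFree G I))

walk : (G : Graph) → V G → ℕ → V G
walk G I₀ zero    = I₀
walk G I₀ (suc i) = follower G (walk G I₀ i)

cyc : ∀ {n} → Fin n → Fin n
cyc {suc n} i with n Data.Nat.≟ toℕ i
... | yes _ = zero
... | no ne = suc (lower₁ i ne)

-- O_{M,q} built from the labelling I_i = walk M I₀ i (p = nV M states):
-- states 0 … pq-1, state j has D_{j mod p} = deg (I_j) edges, all to j+1 mod pq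
O : (M : Graph) → V M → ℕ → Graph
O M I₀ q = record
  { nV       = nV M * q
  ; deg      = λ j → deg M (walk M I₀ (toℕ j))
  ; tgt      = λ j _ → cyc j
  ; sinkFree = λ j → sinkFree M (walk M I₀ (toℕ j))
  }

{-# OPTIONS --safe #-}
module Submission where

-- The graph G carries a phase map onto the cycle of bunches O, and any bijections between
-- out-edges in G and in O turn it into a right-resolver; the task is to choose them ("colour"
-- G) so that the resolver synchronizes.  This is the road colouring theorem for periodic
-- graphs, and Trahtman's proof adapts: as long as some fiber has two states, some colouring
-- has two distinct stable states.  Stability is a congruence, the quotient map is a
-- synchronizer, and synchronizers compose, so one concludes by induction on the number of
-- states.
--
-- For a stable pair, select one out-edge per state and consider the functional graph f of
-- the selected edges, coloured by a single letter.  Either two bunches have a common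
-- target, and are stable, or f can be chosen such that all states farthest from the cycles
-- of f hang on the same cyclic state: otherwise rerouting edges yields more and more cyclic
-- states.  For such an f, a set of pairwise unsynchronizable states moved onto a farthest
-- state meets the farthest states only there; iterating f then moves a single element of
-- the set, which gives a stable pair or a larger such set.

open import Defs
open import Data.Nat using (ℕ; zero; suc; _+_; _*_; _∸_; _%_; _/_; _≤_; _<_; z≤n; s≤s; NonZero; ≢-nonZero)
import Data.Nat as ℕ
open import Data.Nat.Properties hiding (_≟_)
open import Data.Nat.Divisibility using (_∣_; divides; ∣-trans; ∣-antisym; ∣⇒≤; 0∣⇒≡0; _∣0; m%n≡0⇒n∣m)
open import Data.Nat.DivMod using (m≡m%n+[m/n]*n; m%n<n; n%n≡0; m<n⇒m%n≡m; [m+kn]%n≡m%n; %-remove-+ʳ)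
open import Data.Fin using (Fin; zero; suc; _≟_; toℕ; fromℕ<; cast)
open import Data.Fin.Properties using (pigeonhole; any?; all?; injective⇒≤; cantor-schröder-bernstein;
  toℕ<n; toℕ-fromℕ<; toℕ-injective; toℕ-lower₁; toℕ-cast; cast-involutive)
open import Data.Fin.Permutation.Components using (transpose; transpose-inverse)
open import Data.List using (List; []; _∷_; _++_; map; length; foldl; replicate; allFin; cartesianProduct)
open import Data.List.Properties using (map-++; map-∘; length-map; length-++; foldl-++)
open import Data.List.Membership.Propositional using (_∈_)
open import Data.List.Membership.Propositional.Properties using (∈-allFin; ∈-cartesianProduct⁺)
open import Data.List.Relation.Unary.Any using (here; there)
open import Data.Product using (∃; ∃₂; _×_; _,_; proj₁; proj₂)
open import Data.Product.Properties using (≡-dec)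
open import Data.Product.Properties.WithK using (,-injectiveʳ)
open import Data.Sum using (_⊎_; inj₁; inj₂; [_,_]′)
open import Data.Empty using (⊥-elim)
open import Data.Unit using (tt)
open import Relation.Nullary using (¬_; Dec; yes; no; ¬?)
open import Relation.Nullary.Decidable using (map′; _×-dec_; _⊎-dec_; dec-true; decidable-stable)
open import Relation.Unary using (Decidable)
open import Relation.Binary.Definitions using (tri<; tri≈; tri>; DecidableEquality) renaming (Decidable to Decidable₂)
open import Relation.Binary.Structures using (IsEquivalence)
open import Relation.Binary.Construct.Closure.ReflexiveTransitive using (Star; ε; _◅_; _◅◅_)
open import Relation.Binary.PropositionalEquality
open import Function using (_∘_; id)

-- Functional graphs

least : {P : ℕ → Set} → Decidable P → ∀ k → P k → ∃ λ j → P j × (∀ i → i < j → ¬ P i)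
least P? zero pk = zero , pk , λ _ ()
least P? (suc k) pk with P? zero
... | yes p0 = zero , p0 , λ _ ()
... | no ¬p0 with least (P? ∘ suc) k pk
...   | j , pj , min = suc j , pj , λ { zero _ → ¬p0 ; (suc i) (s≤s i<j) → min i i<j }

argmax : ∀ {n} → Fin n → (h : Fin n → ℕ) → ∃ λ i → ∀ j → h j ≤ h i
argmax {suc zero} _ h = zero , λ { zero → ≤-refl }
argmax {suc (suc n)} _ h with argmax zero (h ∘ suc)
... | i , max with ≤-total (h zero) (h (suc i))
...   | inj₁ le = suc i , λ { zero → le ; (suc j) → max j }
...   | inj₂ ge = zero , λ { zero → ≤-refl ; (suc j) → ≤-trans (max j) ge }

iter : {A : Set} → (A → A) → ℕ → A → A
iter f zero    x = x
iter f (suc k) x = f (iter f k x)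

module _ {A : Set} (f : A → A) where

  iter-+ : ∀ m k x → iter f (m + k) x ≡ iter f m (iter f k x)
  iter-+ zero    k x = refl
  iter-+ (suc m) k x = cong f (iter-+ m k x)

  iter-shift : ∀ k x → iter f k (f x) ≡ iter f (suc k) x
  iter-shift zero    x = refl
  iter-shift (suc k) x = cong f (iter-shift k x)

  iter-∸ : ∀ {m k} x → m ≤ k → iter f (k ∸ m) (iter f m x) ≡ iter f k x
  iter-∸ {m} {k} x m≤k = trans (sym (iter-+ (k ∸ m) m x)) (cong (λ i → iter f i x) (m∸n+n≡m m≤k))

  Hits : A → A → Set
  Hits x y = ∃ λ k → iter f k x ≡ y

  Cyc : A → Set
  Cyc x = ∃ λ k → iter f (suc k) x ≡ x

  cyc-iter : ∀ {x} i → Cyc x → Cyc (iter f i x)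
  cyc-iter {x} i (k , e) = k , (begin
    iter f (suc k) (iter f i x) ≡⟨ iter-+ (suc k) i x ⟨
    iter f (suc k + i) x        ≡⟨ cong (λ m → iter f m x) (+-comm (suc k) i) ⟩
    iter f (i + suc k) x        ≡⟨ iter-+ i (suc k) x ⟩
    iter f i (iter f (suc k) x) ≡⟨ cong (iter f i) e ⟩
    iter f i x                  ∎)
    where open ≡-Reasoning

  cyc-hits : ∀ {x y} → Cyc x → Hits x y → Cyc y
  cyc-hits cx (i , refl) = cyc-iter i cx

  hits-trans : ∀ {x y z} → Hits x y → Hits y z → Hits x z
  hits-trans {x} (i , refl) (j , refl) = j + i , iter-+ j i x

  cyc-next : ∀ {x} → Cyc x → Hits (f x) x
  cyc-next {x} (k , e) = k , trans (iter-shift k x) e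

  cyc-pred : ∀ {x y} → Cyc x → Hits x y → Hits y x
  cyc-pred cx (zero , refl) = zero , refl
  cyc-pred {x} cx (suc i , refl) =
    hits-trans (cyc-next (cyc-iter i cx)) (cyc-pred cx (i , refl))

  repeat-cyc : ∀ {i j x} → i < j → iter f i x ≡ iter f j x → Cyc (iter f i x)
  repeat-cyc {i} {j} {x} i<j e with m≤n⇒∃[o]m+o≡n i<j
  ... | o , refl = o , trans (sym (iter-+ (suc o) i x)) (trans (cong (λ k → iter f k x) (cong suc (+-comm o i))) (sym e))

  -- The level `k` of `x` is its distance to the cycles of `f`; its root `r` is the cyclic state at
  -- which the orbit enters them.
  Lev : A → ℕ → A → Set
  Lev x k r = iter f k x ≡ r × Cyc r × (∀ i → i < k → ¬ Cyc (iter f i x))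

  lev-unique : ∀ {x k l r s} → Lev x k r → Lev x l s → k ≡ l × r ≡ s
  lev-unique {k = k} {l} (refl , cr , nr) (refl , cs , ns) with <-cmp k l
  ... | tri< k<l _ _ = ⊥-elim (ns _ k<l cr)
  ... | tri≈ _ refl _ = refl , refl
  ... | tri> _ _ l<k = ⊥-elim (nr _ l<k cs)

  lev-cons : ∀ {x k r} → ¬ Cyc x → Lev (f x) k r → Lev x (suc k) r
  lev-cons {x} {k} nx (e , cr , nr) = trans (sym (iter-shift k x)) e , cr ,
    λ { zero _ → nx ; (suc i) (s≤s i<k) → nr i i<k ∘ subst Cyc (sym (iter-shift i x)) }

  lev-prepend : ∀ {x z l r} j → iter f j x ≡ z → ¬ Cyc z → Lev z l r → Lev x (j + l) r
  lev-prepend zero refl nz lz = lz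
  lev-prepend {x} (suc j) e nz lz =
    lev-cons (λ cx → nz (cyc-hits cx (suc j , e))) (lev-prepend j (trans (iter-shift j x) e) nz lz)

  lev-drop : ∀ {x k r t} → t ≤ k → Lev x k r → Lev (iter f t x) (k ∸ t) r
  lev-drop {x} {k} {r} {t} t≤k (e , cr , nr) = trans (iter-∸ x t≤k) e , cr ,
    λ i i< → nr (i + t) (≤-trans (+-monoˡ-< t i<) (≤-reflexive (m∸n+n≡m t≤k))) ∘ subst Cyc (sym (iter-+ i t x))

  lev-inj : ∀ {x k r i j} → Lev x k r → i < k → j < k → iter f i x ≡ iter f j x → i ≡ j
  lev-inj {i = i} {j} (_ , _ , nr) i<k j<k e with <-cmp i j
  ... | tri< i<j _ _ = ⊥-elim (nr i i<k (repeat-cyc i<j e))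
  ... | tri≈ _ i≡j _ = i≡j
  ... | tri> _ _ j<i = ⊥-elim (nr j j<k (repeat-cyc j<i (sym e)))

module _ {n : ℕ} (f : Fin n → Fin n) where

  repeat : ∀ x → ∃₂ λ i j → i < j × iter f i x ≡ iter f j x
  repeat x with pigeonhole ≤-refl (λ i → iter f (toℕ i) x)
  ... | i , j , i<j , e = toℕ i , toℕ j , i<j , e

  private
    reduce : ∀ {i j} x → i < j → iter f i x ≡ iter f j x → ∀ k → ∃ λ l → l < j × iter f l x ≡ iter f k x
    reduce x i<j e zero = zero , ≤-trans (s≤s z≤n) i<j , refl
    reduce {i} {j} x i<j e (suc k) with reduce x i<j e k
    ... | l , l<j , e′ with m≤n⇒m<n∨m≡n l<j
    ...   | inj₁ sl<j = suc l , sl<j , cong f e′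
    ...   | inj₂ refl = i , i<j , trans e (cong f e′)

  -- Once an orbit repeats at times `i < j`, all its states have occurred before time `j`, so a
  -- bounded search decides.
  hits? : ∀ x y → Dec (Hits f x y)
  hits? x y with repeat x
  ... | i , j , i<j , e =
    map′ (λ { (k , _ , h) → k , h })
         (λ { (k , h) → let l , l<j , e′ = reduce x i<j e k in l , l<j , trans e′ h })
         (anyUpTo? (λ k → iter f k x ≟ y) j)

  first : ∀ {x y} → Hits f x y → ∃ λ k → iter f k x ≡ y × (∀ i → i < k → iter f i x ≢ y)
  first {x} {y} (k , e) = least (λ i → iter f i x ≟ y) k e

  cyc? : ∀ x → Dec (Cyc f x)
  cyc? x = map′ (λ { (k , e) → k , trans (sym (iter-shift f k x)) e }) (cyc-next f) (hits? (f x) x)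

  abstract
    lev : ∀ x → ∃₂ (Lev f x)
    lev x with repeat x
    ... | i , j , i<j , e with least (λ k → cyc? (iter f k x)) i (repeat-cyc f i<j e)
    ...   | k , ck , min = k , iter f k x , refl , ck , min

  Bounded : ℕ → Set
  Bounded L = ∀ {x k r} → Lev f x k r → k ≤ L

  bounded? : ∀ L → Bounded L ⊎ (∃ λ x → ∃₂ λ k r → Lev f x k r × L < k)
  bounded? L with any? (λ x → L <? proj₁ (lev x))
  ... | yes (x , L<k) = inj₂ (x , _ , _ , proj₂ (proj₂ (lev x)) , L<k)
  ... | no none = inj₁ λ {x} l → ≮⇒≥ λ L<k →
        none (x , subst (L <_) (proj₁ (lev-unique f l (proj₂ (proj₂ (lev x))))) L<k)

  HighestRoot : ℕ → Fin n → Set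
  HighestRoot L r = ∀ {x k s} → Lev f x k s → L < k → s ≡ r

  -- Some level exceeds `L`, and all states above `L` share the root `r`. In particular the states
  -- of maximal level have a common root.
  Good : Set
  Good = ∃₂ λ L r → (∃ λ x → ∃₂ λ k s → Lev f x k s × L < k) × HighestRoot L r

  bounded-or-good : ∀ {L r} → HighestRoot L r → Bounded L ⊎ Good
  bounded-or-good {L} hr with bounded? L
  ... | inj₁ bd = inj₁ bd
  ... | inj₂ high = inj₂ (L , _ , high , hr)

  -- A lower bound on the number of cyclic states, the measure that grows while a good choice is
  -- being sought.
  HasCyc : ℕ → Set
  HasCyc m = ∃ λ (g : Fin m → Fin n) → (∀ i j → g i ≡ g j → i ≡ j) × (∀ i → Cyc f (g i))

-- Redirecting one edge of a functional graph

module _ {n : ℕ} (f : Fin n → Fin n) (b p : Fin n) where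

  upd : Fin n → Fin n
  upd x with x ≟ b
  ... | yes _ = p
  ... | no  _ = f x

  upd-at : upd b ≡ p
  upd-at with b ≟ b
  ... | yes _ = refl
  ... | no ne = ⊥-elim (ne refl)

  upd-off : ∀ {x} → x ≢ b → upd x ≡ f x
  upd-off {x} ne with x ≟ b
  ... | yes e = ⊥-elim (ne e)
  ... | no _ = refl

  -- The edge out of `b` matters only after the first visit to `b`, so the orbits agree up to and
  -- including that visit.
  agree : ∀ k {x} → (∀ i → i < k → iter f i x ≢ b) → iter upd k x ≡ iter f k x
  agree zero    off = refl
  agree (suc k) off = trans (cong upd (agree k λ i i<k → off i (m<n⇒m<1+n i<k))) (upd-off (off k ≤-refl))

  avoid : ∀ {x} → ¬ Hits f x b → ∀ k → iter upd k x ≡ iter f k x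
  avoid nh k = agree k λ i _ e → nh (i , e)

  avoid-cyc : ∀ {x} → ¬ Hits f x b → Cyc f x → Cyc upd x
  avoid-cyc nh (k , e) = k , trans (avoid nh (suc k)) e

  avoid-cyc⁻ : ∀ {x} → ¬ Hits f x b → Cyc upd x → Cyc f x
  avoid-cyc⁻ nh (k , e) = k , trans (sym (avoid nh (suc k))) e

  avoid-lev : ∀ {x k r} → ¬ Hits f x b → Lev f x k r → Lev upd x k r
  avoid-lev {x} {k} nh (refl , cr , nr) = avoid nh k , avoid-cyc (later k) cr ,
    λ i i<k c → nr i i<k (avoid-cyc⁻ (later i) (subst (Cyc upd) (avoid nh i) c))
    where later : ∀ i → ¬ Hits f (iter f i x) b
          later i h = nh (hits-trans f (i , refl) h)

  hits-upd : ∀ {x} → Hits f x b → Hits upd x b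
  hits-upd h with first f h
  ... | k , e , min = k , trans (agree k min) e

  noncyc-avoided : ∀ {x} → ¬ Cyc f b → Cyc f x → ¬ Hits f x b
  noncyc-avoided nb cx h = nb (cyc-hits f cx h)

  keep-cycles : ∀ {m} → ¬ Cyc f b → HasCyc f m → HasCyc upd m
  keep-cycles nb (g , inj , cyc) = g , inj , λ i → avoid-cyc (noncyc-avoided nb (cyc i)) (cyc i)

cons-cycle : ∀ {n m} (f : Fin n → Fin n) e → Cyc f e →
             ((g , _) : HasCyc f m) → (∀ i → g i ≢ e) → HasCyc f (suc m)
cons-cycle f e ce (g , inj , cyc) new =
  (λ { zero → e ; (suc i) → g i }) ,
  (λ { zero zero _ → refl
     ; zero (suc j) eq → ⊥-elim (new j (sym eq))
     ; (suc i) zero eq → ⊥-elim (new i eq)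
     ; (suc i) (suc j) eq → cong suc (inj i j eq) }) ,
  (λ { zero → ce ; (suc i) → cyc i })

module _ {n : ℕ} (f : Fin n → Fin n) (b p : Fin n) where

  private f′ = upd f b p

  iter-upd : ∀ k → iter f′ (suc k) b ≡ iter f′ k p
  iter-upd k = trans (sym (iter-shift f′ k b)) (cong (iter f′ k) (upd-at f b p))

  -- The new edge closes a cycle through `b`. The old cycles survive because a cyclic state never
  -- reaches the noncyclic `b`.
  close-cycle : ∀ {m} → ¬ Cyc f b → Hits f p b → HasCyc f m → HasCyc f′ (suc m)
  close-cycle nb h hc@(g , inj , cyc) =
    cons-cycle f′ b cb (keep-cycles f b p nb hc) λ i e → nb (subst (Cyc f) e (cyc i))
    where cb : Cyc f′ b
          cb with hits-upd f b p h
          ... | k , e = k , trans (iter-upd k) e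

  module Detour {L r} (nh : ¬ Hits f p b) (lp : Lev f p L r) where

    noncyc : ¬ Cyc f′ b
    noncyc (k , e) = nh (k , trans (sym (avoid f b p nh k)) (trans (sym (iter-upd k)) e))

    lev-b : Lev f′ b (suc L) r
    lev-b = lev-cons f′ noncyc (subst (λ y → Lev f′ y L r) (sym (upd-at f b p)) (avoid-lev f b p nh lp))

    -- States avoiding `b` keep their level, at most `M`. A state above `M` therefore passes through
    -- `b` and shares its root.
    highest : ∀ {M} → Bounded f M → HighestRoot f′ M r
    highest bd {x} lx M<k with hits? f x b
    ... | yes h with hits-upd f b p h
    ...   | j , e = proj₂ (lev-unique f′ lx (lev-prepend f′ j e noncyc lev-b))
    highest bd {x} lx M<k | no nh′ with lev f x
    ... | _ , _ , l with lev-unique f′ lx (avoid-lev f b p nh′ l)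
    ...   | refl , _ = ⊥-elim (<-irrefl refl (<-≤-trans M<k (bd l)))

  -- The cycle d → … → r → … → b → d is rerouted to p → … → r → … → b → p,
  -- where d = f b; the arc from d to r becomes a tail of length j.
  module Reroute {L r} (cb : Cyc f b) (h : Hits f p b) (lp : Lev f p L r) where

    private
      d = f b

      noncyc-p : ∀ i → i < L → ¬ Cyc f (iter f i p)
      noncyc-p = proj₂ (proj₂ lp)

      cyc-r : Cyc f r
      cyc-r = proj₁ (proj₂ lp)

    from-d : ∀ {y} → Cyc f y → Hits f y b → Hits f d y
    from-d cy hy with cyc-pred f cy hy
    ... | suc i , e = i , trans (iter-shift f i b) e
    ... | zero , refl = cyc-next f cy

    -- The orbit is off the cycles before its root, so it cannot meet the cyclic `b` earlier.
    past : ∀ {x k s} → Lev f x k s → Hits f x b → Hits f s b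
    past {x} {k} (refl , _ , ns) (i , refl) with i <? k
    ... | yes i<k = ⊥-elim (ns i i<k cb)
    ... | no i≮k = i ∸ k , iter-∸ f x (≮⇒≥ i≮k)

    abstract
      hits-r : ∃ λ k → iter f k d ≡ r × (∀ i → i < k → iter f i d ≢ r)
      hits-r = first f (from-d cyc-r (past lp h))

      hits-b : ∃ λ k → iter f k d ≡ b × (∀ i → i < k → iter f i d ≢ b)
      hits-b = first f (cyc-next f cb)

    j β : ℕ
    j = proj₁ hits-r
    β = proj₁ hits-b

    d→r : iter f j d ≡ r
    d→r = proj₁ (proj₂ hits-r)

    d→b : iter f β d ≡ b
    d→b = proj₁ (proj₂ hits-b)

    -- The orbit of `d` restarts at `d` right after time `β`, so a state seen later has been seen
    -- one turn before.
    first-≤β : ∀ {y k} → iter f k d ≡ y → (∀ i → i < k → iter f i d ≢ y) → k ≤ β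
    first-≤β {y} {k} e min = ≮⇒≥ λ β<k → min (k ∸ suc β) (∸-monoʳ-< {k} {suc β} {0} (s≤s z≤n) β<k)
      (trans (cong (iter f (k ∸ suc β)) (sym (cong f d→b))) (trans (iter-∸ f d β<k) e))

    j≤β : j ≤ β
    j≤β = first-≤β d→r (proj₂ (proj₂ hits-r))

    -- A repetition on the arc, continued for `β ∸ t` steps, would reach `b` before its first visit
    -- at time `β`.
    arc-inj : ∀ {s t} → s < t → t ≤ β → iter f s d ≢ iter f t d
    arc-inj {s} {t} s<t t≤β e = proj₂ (proj₂ hits-b) ((β ∸ t) + s)
      (≤-trans (+-monoʳ-< (β ∸ t) s<t) (≤-reflexive (m∸n+n≡m t≤β)))
      (trans (iter-+ f (β ∸ t) s d) (trans (cong (iter f (β ∸ t)) e) (trans (iter-∸ f d t≤β) d→b)))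

    agree-d : ∀ {i} → i ≤ β → iter f′ i d ≡ iter f i d
    agree-d {i} i≤β = agree f b p i λ k k<i → proj₂ (proj₂ hits-b) k (<-≤-trans k<i i≤β)

    agree-lev : ∀ {x k s} → Lev f x k s → ∀ {i} → i ≤ k → iter f′ i x ≡ iter f i x
    agree-lev (_ , _ , ns) {i} i≤k = agree f b p i λ k k<i e → ns k (<-≤-trans k<i i≤k) (subst (Cyc f) (sym e) cb)

    from-r : ∀ {t} → j ≤ t → t ≤ β → iter f′ (t ∸ j) r ≡ iter f t d
    from-r {t} j≤t t≤β = begin
      iter f′ (t ∸ j) r              ≡⟨ cong (iter f′ (t ∸ j)) (trans (agree-d j≤β) d→r) ⟨
      iter f′ (t ∸ j) (iter f′ j d)  ≡⟨ iter-∸ f′ d j≤t ⟩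
      iter f′ t d                    ≡⟨ agree-d t≤β ⟩
      iter f t d                     ∎
      where open ≡-Reasoning

    r→p : iter f′ (suc (β ∸ j)) r ≡ p
    r→p = trans (cong f′ (trans (from-r j≤β ≤-refl) d→b)) (upd-at f b p)

    p→r : iter f′ L p ≡ r
    p→r = trans (agree-lev lp ≤-refl) (proj₁ lp)

    cyc′-r : Cyc f′ r
    cyc′-r = L + (β ∸ j) , (begin
      iter f′ (suc (L + (β ∸ j))) r          ≡⟨ cong (λ k → iter f′ k r) (+-suc L (β ∸ j)) ⟨
      iter f′ (L + suc (β ∸ j)) r            ≡⟨ iter-+ f′ L (suc (β ∸ j)) r ⟩
      iter f′ L (iter f′ (suc (β ∸ j)) r)    ≡⟨ cong (iter f′ L) r→p ⟩
      iter f′ L p                            ≡⟨ p→r ⟩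
      r                                      ∎)
      where open ≡-Reasoning

    cyc′-p : ∀ {i} → i ≤ L → Cyc f′ (iter f i p)
    cyc′-p {i} i≤L = subst (Cyc f′) (agree-lev lp i≤L)
      (cyc-iter f′ i (cyc-hits f′ cyc′-r (suc (β ∸ j) , r→p)))

    cyc′-d : ∀ {t} → j ≤ t → t ≤ β → Cyc f′ (iter f t d)
    cyc′-d {t} j≤t t≤β = cyc-hits f′ cyc′-r (t ∸ j , from-r j≤t t≤β)

    cyc′-b : Cyc f′ b
    cyc′-b = subst (Cyc f′) d→b (cyc′-d j≤β ≤-refl)

    -- The new cycle in full: the old arc from `r` to `b`, then the path from `p` short of `r`.
    NewCycle : Fin n → Set
    NewCycle x = (∃ λ t → j ≤ t × t ≤ β × iter f t d ≡ x) ⊎ (∃ λ i → i < L × iter f i p ≡ x)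

    on-p : ∀ {i} → i ≤ L → NewCycle (iter f i p)
    on-p i≤L with m≤n⇒m<n∨m≡n i≤L
    ... | inj₁ i<L = inj₂ (_ , i<L , refl)
    ... | inj₂ refl = inj₁ (j , ≤-refl , j≤β , trans d→r (sym (proj₁ lp)))

    new-cycle-step : ∀ {x} → NewCycle x → NewCycle (f′ x)
    new-cycle-step (inj₁ (t , j≤t , t≤β , refl)) with m≤n⇒m<n∨m≡n t≤β
    ... | inj₁ t<β = inj₁ (suc t , m≤n⇒m≤1+n j≤t , t<β , sym (upd-off f b p (proj₂ (proj₂ hits-b) t t<β)))
    ... | inj₂ refl = subst NewCycle (sym (trans (cong f′ d→b) (upd-at f b p))) (on-p z≤n)
    new-cycle-step (inj₂ (i , i<L , refl)) = subst NewCycle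
      (sym (upd-off f b p (λ e → noncyc-p i i<L (subst (Cyc f) (sym e) cb)))) (on-p i<L)

    new-cycle-orbit : ∀ k → NewCycle (iter f′ k r)
    new-cycle-orbit zero = inj₁ (j , ≤-refl , j≤β , d→r)
    new-cycle-orbit (suc k) = new-cycle-step (new-cycle-orbit k)

    cyc-d : ∀ i → Cyc f (iter f i d)
    cyc-d i = cyc-iter f i (cyc-iter f 1 cb)

    -- A cyclic state leading to `r` lies on the orbit of `r`, hence in `NewCycle`. The states from
    -- `d` short of `r` do not: the old arc is free of repetitions, and the path from `p` is off the
    -- old cycles.
    lev-d : Lev f′ d j r
    lev-d = trans (agree-d j≤β) d→r , cyc′-r , λ i i<j c →
      off i i<j (subst (Cyc f′) (agree-d (<⇒≤ (<-≤-trans i<j j≤β))) c)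
      where
      off : ∀ i → i < j → ¬ Cyc f′ (iter f i d)
      off i i<j c with cyc-pred f′ c
        (j ∸ i , trans (cong (iter f′ (j ∸ i)) (sym (agree-d (<⇒≤ (<-≤-trans i<j j≤β)))))
                       (trans (iter-∸ f′ d (<⇒≤ i<j)) (trans (agree-d j≤β) d→r)))
      ... | k , e with new-cycle-orbit k
      ...   | inj₁ (t , j≤t , t≤β , e′) = arc-inj (<-≤-trans i<j j≤t) t≤β (sym (trans e′ e))
      ...   | inj₂ (l , l<L , e′) = noncyc-p l l<L (subst (Cyc f) (sym (trans e′ e)) (cyc-d i))

    -- A state that never reaches `b` keeps its level. Any other one enters the old cycle either on
    -- the arc kept in the new cycle, so that its level is still at most `L`, or on the new tail,
    -- which hangs on `r`.
    highest : Bounded f L → HighestRoot f′ L r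
    highest bd {x} lx L<k with hits? f x b
    highest bd {x} lx L<k | no nh with lev f x
    ... | _ , _ , l with lev-unique f′ lx (avoid-lev f b p nh l)
    ...   | refl , _ = ⊥-elim (<-irrefl refl (<-≤-trans L<k (bd l)))
    highest bd {x} lx L<k | yes hx with lev f x
    ... | l , s , ls with first f (from-d (proj₁ (proj₂ ls)) (past ls hx))
    ...   | t , refl , min with t <? j
    ...     | no t≮j = ⊥-elim (proj₂ (proj₂ lx) l (≤-<-trans (bd ls) L<k)
                (subst (Cyc f′) (sym (trans (agree-lev ls ≤-refl) (proj₁ ls)))
                  (cyc′-d (≮⇒≥ t≮j) (first-≤β refl min))))
    ...     | yes t<j = proj₂ (lev-unique f′ lx
                (lev-prepend f′ l (trans (agree-lev ls ≤-refl) (trans (proj₁ ls) (sym e)))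
                  (proj₂ (proj₂ lev-d) t t<j) (lev-drop f′ (<⇒≤ t<j) lev-d)))
      where e = agree-d (<⇒≤ (<-≤-trans t<j j≤β))

    -- Moves the cyclic states of the arc from d to r to the initial segment of the path from p.
    Shift : Fin n → Fin n → Set
    Shift x y = (∃ λ i → i < j × iter f i d ≡ x × iter f i p ≡ y)
              ⊎ ((∀ i → i < j → iter f i d ≢ x) × x ≡ y)

    shift : ∀ x → ∃ (Shift x)
    shift x with anyUpTo? (λ i → iter f i d ≟ x) j
    ... | yes (i , i<j , e) = _ , inj₁ (i , i<j , e , refl)
    ... | no none = x , inj₂ ((λ i i<j e → none (i , i<j , e)) , refl)

    module _ (j≤L : j ≤ L) where

      shift-cyc : ∀ {x y} → Cyc f x → Shift x y → Cyc f′ y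
      shift-cyc cx (inj₁ (i , i<j , _ , refl)) = cyc′-p (<⇒≤ (<-≤-trans i<j j≤L))
      shift-cyc {x} cx (inj₂ (none , refl)) with hits? f x b
      ... | no nh = avoid-cyc f b p nh cx
      ... | yes hx with first f (from-d cx hx)
      ...   | t , refl , min = cyc′-d (≮⇒≥ λ t<j → none t t<j refl) (first-≤β refl min)

      shift-inj : ∀ {x x′ y y′} → Cyc f x → Cyc f x′ → Shift x y → Shift x′ y′ → y ≡ y′ → x ≡ x′
      shift-inj cx cx′ (inj₁ (i , i<j , refl , refl)) (inj₁ (k , k<j , refl , refl)) e =
        cong (λ t → iter f t d) (lev-inj f lp (<-≤-trans i<j j≤L) (<-≤-trans k<j j≤L) e)
      shift-inj cx cx′ (inj₁ (i , i<j , refl , refl)) (inj₂ (_ , refl)) refl =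
        ⊥-elim (noncyc-p i (<-≤-trans i<j j≤L) cx′)
      shift-inj cx cx′ (inj₂ (_ , refl)) (inj₁ (i , i<j , refl , refl)) refl =
        ⊥-elim (noncyc-p i (<-≤-trans i<j j≤L) cx)
      shift-inj cx cx′ (inj₂ (_ , refl)) (inj₂ (_ , refl)) e = e

      shift-cycles : ∀ {m} → HasCyc f m → HasCyc f′ m
      shift-cycles (g , inj , cyc) =
        (λ i → proj₁ (shift (g i))) ,
        (λ i k e → inj i k (shift-inj (cyc i) (cyc k) (proj₂ (shift (g i))) (proj₂ (shift (g k))) e)) ,
        (λ i → shift-cyc (cyc i) (proj₂ (shift (g i))))

    gain-cycle : ∀ {m} → j < L → HasCyc f m → HasCyc f′ (suc m)
    gain-cycle j<L hc@(g , inj , cyc) =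
      cons-cycle f′ (iter f j p) (cyc′-p (<⇒≤ j<L)) (shift-cycles (<⇒≤ j<L) hc)
        λ i e → new (cyc i) (proj₂ (shift (g i))) e
      where
      new : ∀ {x y} → Cyc f x → Shift x y → y ≢ iter f j p
      new cx (inj₁ (i , i<j , _ , refl)) e = <-irrefl (lev-inj f lp (<-trans i<j j<L) j<L e) i<j
      new cx (inj₂ (_ , refl)) refl = noncyc-p j j<L cx

-- Search for a choice of out-edges whose highest states share a root

module ChoiceFunction {n : ℕ} (Edge : Fin n → Fin n → Set) where

  Valid : (Fin n → Fin n) → Set
  Valid f = ∀ x → Edge x (f x)

  Outcome : ℕ → Set
  Outcome m = (∃ λ f → Valid f × Good f) ⊎ (∃ λ f → Valid f × HasCyc f (suc m))

  valid-upd : ∀ {f b p} → Valid f → Edge b p → Valid (upd f b p)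
  valid-upd {b = b} vf e x with x ≟ b
  ... | yes refl = e
  ... | no _ = vf x

  -- The balanced case: arc and path into `r` have the same length and rerouting gains nothing. The
  -- data are symmetric: in `upd f b p` the states `p` and `f b` have exchanged their roles.
  record Stuck (f : Fin n → Fin n) (b p : Fin n) (L : ℕ) (r : Fin n) (m : ℕ) : Set where
    field
      cyc-b   : Cyc f b
      arc     : iter f L (f b) ≡ r
      cyc′-b  : Cyc (upd f b p) b
      arc′    : iter (upd f b p) L p ≡ r
      cycles′ : HasCyc (upd f b p) m
      lev′    : Lev (upd f b p) (f b) L r
      bound′  : Bounded (upd f b p) L
      agree′  : ∀ {i} → i ≤ L → iter (upd f b p) i (f b) ≡ iter f i (f b)

  -- If `p` misses `b`, then `b` becomes a highest state; if `b` is noncyclic, a cycle is closed.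
  -- Otherwise a shorter arc gains a cyclic state and a longer one leaves a tail above level `L`, so
  -- only equal lengths can be stuck.
  reroute : ∀ {f b p L r m} → Valid f → Bounded f L → HasCyc f m → Edge b p → Lev f p L r →
            Outcome m ⊎ Stuck f b p L r m
  reroute {f} {b} {p} {L} {r} vf bd hc e lp with hits? f p b
  ... | no nh = inj₁ (inj₁ (upd f b p , valid-upd vf e , L , r ,
                  (b , suc L , r , D.lev-b , ≤-refl) , D.highest bd))
    where module D = Detour f b p nh lp
  ... | yes h with cyc? f b
  ...   | no nb = inj₁ (inj₂ (upd f b p , valid-upd vf e , close-cycle f b p nb h hc))
  ...   | yes cb with <-cmp (Reroute.j f b p cb h lp) L
  ...     | tri< j<L _ _ = inj₁ (inj₂ (upd f b p , valid-upd vf e , Reroute.gain-cycle f b p cb h lp j<L hc))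
  ...     | tri> _ _ L<j = inj₁ (inj₁ (upd f b p , valid-upd vf e , L , r ,
                  (f b , R.j , r , R.lev-d , L<j) , R.highest bd))
    where module R = Reroute f b p cb h lp
  ...     | tri≈ _ j≡L _ with bounded-or-good (upd f b p) (Reroute.highest f b p cb h lp bd)
  ...       | inj₂ good = inj₁ (inj₁ (upd f b p , valid-upd vf e , good))
  ...       | inj₁ bd′ = inj₂ (record
    { cyc-b   = cb
    ; arc     = subst (λ k → iter f k (f b) ≡ r) j≡L R.d→r
    ; cyc′-b  = R.cyc′-b
    ; arc′    = R.p→r
    ; cycles′ = R.shift-cycles (≤-reflexive j≡L) hc
    ; lev′    = subst (λ k → Lev (upd f b p) (f b) k r) j≡L R.lev-d
    ; bound′  = bd′
    ; agree′  = λ i≤L → R.agree-d (≤-trans i≤L (≤-trans (≤-reflexive (sym j≡L)) R.j≤β))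
    })
    where module R = Reroute f b p cb h lp

  -- Redirecting the last edge of the path from p moves its root, so the two arcs
  -- into the root can no longer have the same length.
  redirect : ∀ {f b p L r m g} → Valid f → Bounded f (suc L) → HasCyc f m → Edge b p →
             Lev f p (suc L) r → Cyc f b → iter f (suc L) (f b) ≡ r →
             Edge (iter f L p) g → g ≢ r → Outcome m
  redirect {f} {b} {p} {L} {r} {m} {g} vf bd hc e lp cb arc eg g≢r with hits? f g (iter f L p)
  ... | yes h = inj₂ (upd f (iter f L p) g , valid-upd vf eg ,
                  close-cycle f (iter f L p) g (proj₂ (proj₂ lp) L ≤-refl) h hc)
  ... | no nh with lev f g
  ... | k , s , lg = result (bounded-or-good f′ (D.highest bd))
    where
    c = iter f L p
    f′ = upd f c g
    module D = Detour f c g nh lg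

    nc : ¬ Cyc f c
    nc = proj₂ (proj₂ lp) L ≤-refl

    result : Bounded f′ (suc L) ⊎ Good f′ → Outcome m
    result (inj₂ good) = inj₁ (f′ , valid-upd vf eg , good)
    result (inj₁ bd′) with lev-prepend f′ L p→c D.noncyc D.lev-b
      where
      p→c : iter f′ L p ≡ c
      p→c = agree f c g L λ i i<L e → nc (subst (Cyc f) e (repeat-cyc f i<L e))
    -- Now `p` has level `L + suc k`, where `k` is the level of `g`; the bound `suc L` forces `k` to
    -- be 0, so `g` is its own root.
    ... | lp′ with n≤0⇒n≡0 (≤-pred (+-cancelˡ-≤ L (suc k) 1 (≤-trans (bd′ lp′) (≤-reflexive (+-comm 1 L)))))
    ... | refl with reroute (valid-upd vf eg) bd′ (keep-cycles f c g nc hc) e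
                      (subst (λ i → Lev f′ p i s) (+-comm L 1) lp′)
    ... | inj₁ out = out
    -- The arc from `f b` consists of cyclic states, is untouched by the redirection and still ends
    -- in `r`; being stuck again would make it end in `g`.
    ... | inj₂ stuck = ⊥-elim (g≢r (trans (proj₁ lg) (trans (sym (Stuck.arc stuck)) (trans same arc))))
      where
      same : iter f′ (suc L) (f′ b) ≡ iter f (suc L) (f b)
      same = trans (iter-shift f′ (suc L) b)
               (trans (avoid f c g (noncyc-avoided f c g nc cb) (suc (suc L))) (sym (iter-shift f (suc L) b)))

  module _ (pred : ∀ p → ∃ λ b → Edge b p)
           (fork : ∃ λ v → ∃₂ λ s t → Edge v s × Edge v t × s ≢ t)
           (no-twins : ∀ {c e r} → c ≢ e → Edge c r → Edge e r →
              (∃ λ g → Edge c g × g ≢ r) ⊎ (∃ λ g → Edge e g × g ≢ r)) where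

    -- When all states are cyclic, path and arc have length 0 in the stuck case, which would make
    -- `f v` and `s` equal.
    improve-flat : ∀ {f m v s} → Valid f → Bounded f 0 → HasCyc f m → Edge v s → s ≢ f v → Outcome m
    improve-flat {f} {v = v} {s} vf bd hc e s≢fv with lev f s
    ... | k , r , ls with n≤0⇒n≡0 (bd ls)
    ... | refl with reroute vf bd hc e ls
    ...   | inj₁ out = out
    ...   | inj₂ stuck = ⊥-elim (s≢fv (trans (proj₁ ls) (sym (Stuck.arc stuck))))

    -- Reroute a predecessor of a highest state `p`. If stuck, the last states before `r` on the
    -- path and on the arc differ, one being noncyclic and the other cyclic; as they are not twins,
    -- one of them has an edge leading elsewhere.
    improve-at : ∀ {f m} L {p r} → Valid f → Bounded f L → HasCyc f m → Lev f p L r → Outcome m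
    improve-at {f} zero vf bd hc lp = at-fork fork
      where
      at-fork : (∃ λ v → ∃₂ λ s t → Edge v s × Edge v t × s ≢ t) → Outcome _
      at-fork (v , s , t , es , et , s≢t) with s ≟ f v
      ... | no s≢fv = improve-flat vf bd hc es s≢fv
      ... | yes refl = improve-flat vf bd hc et (λ t≡ → s≢t (sym t≡))
    improve-at {f} (suc L) {p} {r} vf bd hc lp with pred p
    ... | b , e with reroute vf bd hc e lp
    ...   | inj₁ out = out
    ...   | inj₂ stuck with no-twins c≢e (last (proj₁ lp)) (last (Stuck.arc stuck))
      where
      last : ∀ {x} → iter f (suc L) x ≡ r → Edge (iter f L x) r
      last {x} e = subst (Edge (iter f L x)) e (vf _)
      c≢e : iter f L p ≢ iter f L (f b)
      c≢e c≡e = proj₂ (proj₂ lp) L ≤-refl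
        (subst (Cyc f) (sym c≡e) (cyc-iter f L (cyc-iter f 1 (Stuck.cyc-b stuck))))
    ...     | inj₁ (g , eg , g≢r) = redirect vf bd hc e lp (Stuck.cyc-b stuck) (Stuck.arc stuck) eg g≢r
    -- The free edge is at the end of the arc, which is the path from the highest state `f b` after
    -- rerouting; so the argument is repeated for `upd f b p`.
    ...     | inj₂ (g , eg , g≢r) =
      redirect (valid-upd vf e) bound′ cycles′ (vf b) lev′ cyc′-b
        (trans (cong (iter (upd f b p) (suc L)) (upd-at f b p)) arc′)
        (subst (λ x → Edge x g) (sym (agree′ (n≤1+n L))) eg) g≢r
      where open Stuck stuck

    improve : ∀ {f m} → Fin n → Valid f → HasCyc f m → Outcome m
    improve {f} x vf hc = improve-at (proj₁ (lev f p)) vf bd hc (proj₂ (proj₂ (lev f p)))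
      where
      highest = argmax x (λ y → proj₁ (lev f y))
      p = proj₁ highest
      bd : Bounded f (proj₁ (lev f p))
      bd {y} ly = ≤-trans (≤-reflexive (proj₁ (lev-unique f ly (proj₂ (proj₂ (lev f y)))))) (proj₂ highest y)

    -- Every failure adds a cyclic state, and there are at most `n` of them.
    search : ∀ fuel {f m} → n < m + fuel → Fin n → Valid f → HasCyc f m → ∃ λ f → Valid f × Good f
    search zero {m = m} n<m x vf (g , inj , _) =
      ⊥-elim (<-irrefl refl (<-≤-trans n<m (≤-trans (≤-reflexive (+-identityʳ m)) (injective⇒≤ (inj _ _)))))
    search (suc fuel) {m = m} lt x vf hc with improve x vf hc
    ... | inj₁ good = good
    ... | inj₂ (_ , vf′ , hc′) = search fuel (≤-trans lt (≤-reflexive (+-suc m fuel))) x vf′ hc′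

    good-choice : ∀ {f} → Fin n → Valid f → ∃ λ f → Valid f × Good f
    good-choice x vf = search (suc n) {m = 0} ≤-refl x vf ((λ ()) , (λ ()) , λ ())

-- Stable pairs of automata

-- Warshall's algorithm: Through zs x y asks for a walk whose intermediate points lie in zs.
module _ {A : Set} {R : A → A → Set} where

  Through : List A → A → A → Set
  Through []       x y = x ≡ y ⊎ R x y
  Through (z ∷ zs) x y = Through zs x y ⊎ (Through zs x z × Through zs z y)

  through-edge : ∀ zs {x y} → x ≡ y ⊎ R x y → Through zs x y
  through-edge []       e = e
  through-edge (z ∷ zs) e = inj₁ (through-edge zs e)

  -- Where both walks visit the head of the list, the part between the first and the last visit is
  -- cut out.
  through-trans : ∀ {zs x y z} → z ∈ zs → Through zs x z → Through zs z y → Through zs x y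
  through-trans (here refl) (inj₁ a) (inj₁ b)             = inj₂ (a , b)
  through-trans (here refl) (inj₁ a) (inj₂ (_ , b))       = inj₂ (a , b)
  through-trans (here refl) (inj₂ (a , _)) (inj₁ b)       = inj₂ (a , b)
  through-trans (here refl) (inj₂ (a , _)) (inj₂ (_ , b)) = inj₂ (a , b)
  through-trans (there m) (inj₁ a) (inj₁ b)               = inj₁ (through-trans m a b)
  through-trans (there m) (inj₁ a) (inj₂ (b , c))         = inj₂ (through-trans m a b , c)
  through-trans (there m) (inj₂ (a , b)) (inj₁ c)         = inj₂ (a , through-trans m b c)
  through-trans (there m) (inj₂ (a , _)) (inj₂ (_ , b))   = inj₂ (a , b)

  through⇒star : ∀ zs {x y} → Through zs x y → Star R x y
  through⇒star []       (inj₁ refl)    = ε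
  through⇒star []       (inj₂ r)       = r ◅ ε
  through⇒star (z ∷ zs) (inj₁ t)       = through⇒star zs t
  through⇒star (z ∷ zs) (inj₂ (t , u)) = through⇒star zs t ◅◅ through⇒star zs u

  star⇒through : ∀ {zs} → (∀ z → z ∈ zs) → ∀ {x y} → Star R x y → Through zs x y
  star⇒through {zs} all ε = through-edge zs (inj₁ refl)
  star⇒through {zs} all (r ◅ s) = through-trans (all _) (through-edge zs (inj₂ r)) (star⇒through all s)

  module _ (_≟A_ : DecidableEquality A) (R? : ∀ x y → Dec (R x y)) where

    through? : ∀ zs x y → Dec (Through zs x y)
    through? []       x y = (x ≟A y) ⊎-dec R? x y
    through? (z ∷ zs) x y = through? zs x y ⊎-dec (through? zs x z ×-dec through? zs z y)

    star? : ∀ {zs} → (∀ z → z ∈ zs) → ∀ x y → Dec (Star R x y)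
    star? {zs} all x y = map′ (through⇒star zs) (star⇒through all) (through? zs x y)

iter-multiple : ∀ {A : Set} (f : A → A) q l {x} → iter f l x ≡ x → iter f (q * l) x ≡ x
iter-multiple f zero    l e = refl
iter-multiple f (suc q) l e = trans (iter-+ f l (q * l) _) (trans (cong (iter f l) (iter-multiple f q l e)) e)

common-period : ∀ {A : Set} (f : A → A) {m} (g : Fin m → A) → (∀ i → Cyc f (g i)) →
                ∃ λ M → ∀ i → iter f (suc M) (g i) ≡ g i
common-period f {zero} g cyc = zero , λ ()
common-period f {suc m} g cyc with common-period f (g ∘ suc) (cyc ∘ suc) | cyc zero
-- The successor of this witness is the product `suc M * suc k` of the two periods.
... | M , per | k , e = k + M * suc k , λ
  { zero → iter-multiple f (suc M) (suc k) e
  ; (suc i) → trans (cong (λ l → iter f l (g (suc i))) (*-comm (suc M) (suc k))) (iter-multiple f (suc k) (suc M) (per i)) }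

-- Take `k` one less than the maximal level: a state still off the cycles after `k` steps has
-- maximal level and enters them at the common root in one more step.
peak : ∀ {n} {f : Fin n → Fin n} → Good f → ∃ λ k → ∃₂ λ p r →
       ¬ Cyc f (iter f k p) × (∀ x → ¬ Cyc f (iter f k x) → iter f (suc k) x ≡ r)
peak {n} {f} (L , r , (x₀ , k₀ , _ , l₀ , L<k₀) , root) with argmax x₀ (λ x → proj₁ (lev f x))
... | p , max with lev f p in eq
... | k , s , lp with m≤n⇒∃[o]m+o≡n (<-≤-trans L<k₀ (≤-trans (≤-reflexive (proj₁ (lev-unique f l₀ (proj₂ (proj₂ (lev f x₀)))))) (max x₀)))
... | o , refl = L + o , p , r , proj₂ (proj₂ lp) (L + o) ≤-refl , top
  where
  top : ∀ x → ¬ Cyc f (iter f (L + o) x) → iter f (suc (L + o)) x ≡ r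
  top x nc with lev f x | max x
  ... | l , t , lx | l≤ with m≤n⇒m<n∨m≡n l≤
  ...   | inj₁ l<k = ⊥-elim (nc (subst (Cyc f) (iter-∸ f x (≤-pred l<k))
                        (cyc-iter f (L + o ∸ l) (subst (Cyc f) (sym (proj₁ lx)) (proj₁ (proj₂ lx))))))
  ...   | inj₂ refl = trans (proj₁ lx) (root lx (s≤s (m≤m+n L o)))

module Automaton {n K : ℕ} (δ : Fin n → Fin K → Fin n) where

  run : Fin n → List (Fin K) → Fin n
  run = foldl δ

  run-++ : ∀ x u v → run x (u ++ v) ≡ run (run x u) v
  run-++ = foldl-++ δ

  Sync : Fin n → Fin n → Set
  Sync x y = ∃ λ w → run x w ≡ run y w

  StablePair : Fin n → Fin n → Set
  StablePair x y = ∀ u → Sync (run x u) (run y u)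

  sync-run⁻ : ∀ {x y} u → Sync (run x u) (run y u) → Sync x y
  sync-run⁻ {x} {y} u (w , e) = u ++ w , trans (run-++ x u w) (trans e (sym (run-++ y u w)))

  stable-refl : ∀ {x} → StablePair x x
  stable-refl u = [] , refl

  stable-sym : ∀ {x y} → StablePair x y → StablePair y x
  stable-sym s u = proj₁ (s u) , sym (proj₂ (s u))

  stable-trans : ∀ {x y z} → StablePair x y → StablePair y z → StablePair x z
  stable-trans {x} {y} {z} s t u with s u
  ... | v , e with t (u ++ v)
  ...   | w , e′ = v ++ w , (begin
      run (run x u) (v ++ w)    ≡⟨ run-++ (run x u) v w ⟩
      run (run (run x u) v) w   ≡⟨ cong (λ s → run s w) e ⟩
      run (run (run y u) v) w   ≡⟨ cong (λ s → run s w) (run-++ y u v) ⟨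
      run (run y (u ++ v)) w    ≡⟨ e′ ⟩
      run (run z (u ++ v)) w    ≡⟨ cong (λ s → run s w) (run-++ z u v) ⟩
      run (run (run z u) v) w   ≡⟨ run-++ (run z u) v w ⟨
      run (run z u) (v ++ w)    ∎)
    where open ≡-Reasoning

  stable-step : ∀ {x y} a → StablePair x y → StablePair (δ x a) (δ y a)
  stable-step a s u = s (a ∷ u)

  private
    Pair : Set
    Pair = Fin n × Fin n

    Step : Pair → Pair → Set
    Step (x , y) (x′ , y′) = ∃ λ a → δ x a ≡ x′ × δ y a ≡ y′

    -- Synchronizability and stability become reachability questions in the finite square of the
    -- automaton.
    reach? : ∀ s t → Dec (Star Step s t)
    reach? = star? (≡-dec _≟_ _≟_) (λ { (x , y) (x′ , y′) → any? λ a → (δ x a ≟ x′) ×-dec (δ y a ≟ y′) })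
      (λ { (x , y) → ∈-cartesianProduct⁺ (∈-allFin x) (∈-allFin y) })

    word : ∀ {x y x′ y′} → Star Step (x , y) (x′ , y′) → ∃ λ w → run x w ≡ x′ × run y w ≡ y′
    word ε = [] , refl , refl
    word ((a , refl , refl) ◅ s) with word s
    ... | w , e , e′ = a ∷ w , e , e′

    reach : ∀ {x y} w → Star Step (x , y) (run x w , run y w)
    reach []      = ε
    reach (a ∷ w) = (a , refl , refl) ◅ reach w

  sync? : ∀ x y → Dec (Sync x y)
  sync? x y = map′
    (λ { (z , s) → let w , e , e′ = word s in w , trans e (sym e′) })
    (λ { (w , e) → run x w , subst (λ t → Star Step (x , y) (run x w , t)) (sym e) (reach w) })
    (any? λ z → reach? (x , y) (z , z))

  stable-or-deadlock : ∀ x y → StablePair x y ⊎ (∃ λ u → ¬ Sync (run x u) (run y u))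
  stable-or-deadlock x y with any? (λ x′ → any? (λ y′ → reach? (x , y) (x′ , y′) ×-dec ¬? (sync? x′ y′)))
  ... | yes (x′ , y′ , s , ns) with word s
  ...   | u , refl , refl = inj₂ (u , ns)
  stable-or-deadlock x y | no none = inj₁ stable
    where
    stable : StablePair x y
    stable u with sync? (run x u) (run y u)
    ... | yes s = s
    ... | no ns = ⊥-elim (none (run x u , run y u , reach u , ns))

  stable? : ∀ x y → Dec (StablePair x y)
  stable? x y with stable-or-deadlock x y
  ... | inj₁ s = yes s
  ... | inj₂ (u , ns) = no λ s → ns (s u)

  -- By `sync-run⁻` every word carries a clique to a clique of the same size.
  Clique : ℕ → Set
  Clique m = ∃ λ (g : Fin m → Fin n) → ∀ i j → i ≢ j → ¬ Sync (g i) (g j)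

  clique-≤ : ∀ {m} → Clique m → m ≤ n
  clique-≤ (g , dead) = injective⇒≤ {f = g} inj
    where
    inj : ∀ {i j} → g i ≡ g j → i ≡ j
    inj {i} {j} e with i ≟ j
    ... | yes i≡j = i≡j
    ... | no i≢j = ⊥-elim (dead i j i≢j ([] , e))

  module _ (connected : ∀ x y → ∃ λ w → run x w ≡ y)
           (z : Fin K) {f : Fin n → Fin n} (z-acts : ∀ x → δ x z ≡ f x) where

    run-replicate : ∀ k x → run x (replicate k z) ≡ iter f k x
    run-replicate zero    x = refl
    run-replicate (suc k) x = trans (run-replicate k (δ x z))
      (trans (cong (iter f k) (z-acts x)) (iter-shift f k x))

    sync-iter⁻ : ∀ {x y} k → Sync (iter f k x) (iter f k y) → Sync x y
    sync-iter⁻ {x} {y} k s = sync-run⁻ (replicate k z)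
      (subst₂ Sync (sym (run-replicate k x)) (sym (run-replicate k y)) s)

    DistinctStable : Set
    DistinctStable = ∃₂ λ x y → x ≢ y × StablePair x y

    -- Steer the clique so that its first member is the only one that is still off the cycles
    -- of f after k steps.  Turning all cycles around then changes that member alone; the
    -- changed state is stable with the old one, or else joins an image of the clique.
    enlarge : Good f → ∀ {m} → Clique (suc m) → DistinctStable ⊎ Clique (suc (suc m))
    enlarge good {m} (g , dead) with peak good
    ... | k , p , r , off , top with connected (g zero) p
    ... | w , g₀→p = split (stable-or-deadlock (A zero) y)
      where
      A : Fin (suc m) → Fin n
      A i = iter f k (run (g i) w)

      deadA : ∀ i j → i ≢ j → ¬ Sync (A i) (A j)
      deadA i j i≢j s = dead i j i≢j (sync-run⁻ w (sync-iter⁻ k s))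

      offA : ¬ Cyc f (A zero)
      offA = subst (λ x → ¬ Cyc f (iter f k x)) (sym g₀→p) off

      cycA : ∀ i → Cyc f (A (suc i))
      cycA i with cyc? f (A (suc i))
      ... | yes c = c
      -- Two members off the cycles would meet at `r` after one more step.
      ... | no nc = ⊥-elim (deadA (suc i) zero (λ ()) (sync-iter⁻ 1 ([] , trans (top _ nc) (sym (top _ offA)))))

      M : ℕ
      M = proj₁ (common-period f (A ∘ suc) cycA)

      y : Fin n
      y = iter f (suc M) (A zero)

      dead-y : ∀ i → ¬ Sync y (A (suc i))
      -- The common period fixes the cyclic members, so `y` and `A (suc i)` are the images of
      -- `A zero` and `A (suc i)` under the same iterate.
      dead-y i s = deadA zero (suc i) (λ ()) (sync-iter⁻ (suc M)
        (subst (Sync y) (sym (proj₂ (common-period f (A ∘ suc) cycA) i)) s))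

      split : StablePair (A zero) y ⊎ (∃ λ u → ¬ Sync (run (A zero) u) (run y u)) →
              DistinctStable ⊎ Clique (suc (suc m))
      split (inj₁ st) = inj₁ (A zero , y , (λ e → offA (M , sym e)) , st)
      split (inj₂ (u , ns)) = inj₂ (h , deadh)
        where
        h : Fin (suc (suc m)) → Fin n
        h zero    = run y u
        h (suc i) = run (A i) u

        dead-yu : ∀ i → ¬ Sync (run y u) (run (A i) u)
        dead-yu zero (v , e) = ns (v , sym e)
        dead-yu (suc i) s = dead-y i (sync-run⁻ u s)

        deadh : ∀ i j → i ≢ j → ¬ Sync (h i) (h j)
        deadh zero zero ne = ⊥-elim (ne refl)
        deadh zero (suc j) _ = dead-yu j
        deadh (suc i) zero _ (v , e) = dead-yu i (v , sym e)
        deadh (suc i) (suc j) ne s = deadA i j (ne ∘ cong suc) (sync-run⁻ u s)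

    enlarge-all : Good f → ∀ fuel {m} → n < suc m + fuel → Clique (suc m) → DistinctStable
    enlarge-all good zero {m} n<m c =
      ⊥-elim (<-irrefl refl (<-≤-trans n<m (≤-trans (≤-reflexive (+-identityʳ (suc m))) (clique-≤ c))))
    enlarge-all good (suc fuel) {m} lt c =
      [ id , enlarge-all good fuel (≤-trans lt (≤-reflexive (+-suc (suc m) fuel))) ]′ (enlarge good c)

    good⇒stable : Fin n → Good f → DistinctStable
    good⇒stable x good = enlarge-all good n (≤-refl {suc n}) ((λ _ → x) , λ { zero zero ne → ⊥-elim (ne refl) })

-- Right-resolvers

path-++ : ∀ (G : Graph) I γ {δ} → IsPathFrom G I γ → IsPathFrom G (end G I γ) δ → IsPathFrom G I (γ ++ δ)
path-++ G I []      _       q = q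
path-++ G I (e ∷ γ) (s , p) q = s , path-++ G (trg G e) γ p q

end-++ : ∀ (G : Graph) I γ δ → end G I (γ ++ δ) ≡ end G (end G I γ) δ
end-++ G I []      δ = refl
end-++ G I (e ∷ γ) δ = end-++ G (trg G e) γ δ

module _ {G H : Graph} (R : RightResolver G H) where

  private
    ∂ = vmap (hom R)
    Φ = emap (hom R)

  path-image : ∀ I γ → IsPathFrom G I γ → IsPathFrom H (∂ I) (map Φ γ)
  path-image I []      _          = tt
  path-image I (e ∷ γ) (refl , p) = src-comm (hom R) e ,
    subst (λ J → IsPathFrom H J (map Φ γ)) (sym (trg-comm (hom R) e)) (path-image (trg G e) γ p)

  end-image : ∀ I γ → end H (∂ I) (map Φ γ) ≡ ∂ (end G I γ)
  end-image I []      = refl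
  end-image I (e ∷ γ) = trans (cong (λ J → end H J (map Φ γ)) (trg-comm (hom R) e)) (end-image (trg G e) γ)

  lift : ∀ I u → IsPathFrom H (∂ I) u → ∃ λ γ → IsPathFrom G I γ × map Φ γ ≡ u
  lift I []            _          = [] , tt , refl
  lift I ((_ , l) ∷ u) (refl , p) with local-bij R I l
  ... | k , e , _ with lift (tgt G I k) u
        (subst (λ J → IsPathFrom H J u) (trans (cong (trg H) (sym e)) (trg-comm (hom R) (I , k))) p)
  ...   | γ , q , e′ = (I , k) ∷ γ , (refl , q) , cong₂ _∷_ e e′

  -- By uniqueness of lifts, the edge picked inside `dot` is any lift already at hand.
  dot-step : ∀ I k e fs → Φ (I , k) ≡ e → dot R I (e ∷ fs) ≡ dot R (tgt G I k) fs
  dot-step I k (J , l) fs p with J ≟ ∂ I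
  ... | yes refl = cong (λ k → dot R (tgt G I k) fs) (proj₂ (proj₂ (local-bij R I l)) p)
  ... | no ne = ⊥-elim (ne (trans (cong proj₁ (sym p)) (src-comm (hom R) (I , k))))

  dot-image : ∀ I γ → IsPathFrom G I γ → dot R I (map Φ γ) ≡ end G I γ
  dot-image I []            _          = refl
  dot-image I ((_ , k) ∷ γ) (refl , p) =
    trans (dot-step I k (Φ (I , k)) (map Φ γ) refl) (dot-image (tgt G I k) γ p)

  -- Every pair of paths with a common image again ends in a common fiber, so in the
  -- definition of a synchronizer the prefix u can be dropped.
  Merging : Set
  Merging = ∀ I₁ I₂ → ∂ I₁ ≡ ∂ I₂ → ∃₂ λ γ₁ γ₂ →
    IsPathFrom G I₁ γ₁ × IsPathFrom G I₂ γ₂ × map Φ γ₁ ≡ map Φ γ₂ × end G I₁ γ₁ ≡ end G I₂ γ₂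

  synchronizer⇒merging : IsSynchronizer R → Merging
  synchronizer⇒merging sync I₁ I₂ same with proj₂ (sync (∂ I₂) I₁ I₂ same refl) [] tt
  ... | v , p , dots with lift I₁ v p | lift I₂ v (subst (λ J → IsPathFrom H J v) same p)
  ...   | γ₁ , p₁ , refl | γ₂ , p₂ , e₂ = γ₁ , γ₂ , p₁ , p₂ , sym e₂ ,
          trans (sym (dot-image I₁ γ₁ p₁)) (trans dots (trans (cong (dot R I₂) (sym e₂)) (dot-image I₂ γ₂ p₂)))

  merging⇒synchronizer : Merging → IsSynchronizer R
  merging⇒synchronizer merge J I₁ I₂ i₁ i₂ = same , stable
    where
    same : ∂ I₁ ≡ ∂ I₂
    same = trans i₁ (sym i₂)
    stable : ∀ u → IsPathFrom H (∂ I₁) u → ∃ λ v → IsPathFrom H (end H (∂ I₁) u) v ×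
             dot R I₁ (u ++ v) ≡ dot R I₂ (u ++ v)
    stable u p with lift I₁ u p | lift I₂ u (subst (λ J → IsPathFrom H J u) same p)
    ... | γ₁ , p₁ , refl | γ₂ , p₂ , e₂ with merge (end G I₁ γ₁) (end G I₂ γ₂)
          (trans (sym (end-image I₁ γ₁)) (trans (cong₂ (end H) same (sym e₂)) (end-image I₂ γ₂)))
    ...   | δ₁ , δ₂ , q₁ , q₂ , e , ends = map Φ δ₁ ,
      subst (λ J → IsPathFrom H J (map Φ δ₁)) (sym (end-image I₁ γ₁)) (path-image _ δ₁ q₁) , (begin
      dot R I₁ (map Φ γ₁ ++ map Φ δ₁)  ≡⟨ cong (dot R I₁) (map-++ Φ γ₁ δ₁) ⟨
      dot R I₁ (map Φ (γ₁ ++ δ₁))      ≡⟨ dot-image I₁ (γ₁ ++ δ₁) (path-++ G I₁ γ₁ p₁ q₁) ⟩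
      end G I₁ (γ₁ ++ δ₁)              ≡⟨ end-++ G I₁ γ₁ δ₁ ⟩
      end G (end G I₁ γ₁) δ₁           ≡⟨ ends ⟩
      end G (end G I₂ γ₂) δ₂           ≡⟨ end-++ G I₂ γ₂ δ₂ ⟨
      end G I₂ (γ₂ ++ δ₂)              ≡⟨ dot-image I₂ (γ₂ ++ δ₂) (path-++ G I₂ γ₂ p₂ q₂) ⟨
      dot R I₂ (map Φ (γ₂ ++ δ₂))      ≡⟨ cong (dot R I₂) (map-++ Φ γ₂ δ₂) ⟩
      dot R I₂ (map Φ γ₂ ++ map Φ δ₂)  ≡⟨ cong (dot R I₂) (cong₂ _++_ e₂ (sym e)) ⟩
      dot R I₂ (map Φ γ₁ ++ map Φ δ₁)  ∎)
      where open ≡-Reasoning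

  injective⇒merging : (∀ {I J} → ∂ I ≡ ∂ J → I ≡ J) → Merging
  injective⇒merging inj I₁ I₂ e = [] , [] , tt , tt , refl , inj e

  connected-image : StronglyConnected G → StronglyConnected H
  connected-image sc J₁ J₂ with vmap-surj R J₁ | vmap-surj R J₂
  ... | I₁ , refl | I₂ , refl with sc I₁ I₂
  ...   | γ , p , refl = map Φ γ , path-image I₁ γ p , end-image I₁ γ

  cycle-image : ∀ {I γ} → IsCycle G I γ → IsCycle H (∂ I) (map Φ γ)
  cycle-image {I} {γ} (p , e , l) = path-image I γ p , trans (end-image I γ) (cong ∂ e) ,
    ≤-trans l (≤-reflexive (sym (length-map Φ γ)))

_∘R_ : ∀ {G H K : Graph} → RightResolver H K → RightResolver G H → RightResolver G K
hom (S ∘R R) = record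
  { vmap     = vmap (hom S) ∘ vmap (hom R)
  ; emap     = emap (hom S) ∘ emap (hom R)
  ; src-comm = λ e → trans (src-comm (hom S) _) (cong (vmap (hom S)) (src-comm (hom R) e))
  ; trg-comm = λ e → trans (trg-comm (hom S) _) (cong (vmap (hom S)) (trg-comm (hom R) e))
  }
emap-surj (S ∘R R) g with emap-surj S g
... | f , refl with emap-surj R f
...   | e , refl = e , refl
vmap-surj (S ∘R R) K with vmap-surj S K
... | J , refl with vmap-surj R J
...   | I , refl = I , refl
local-bij (S ∘R R) I f with local-bij S (vmap (hom R) I) f
... | l , e , uniqS with local-bij R I l
...   | k , e′ , uniqR = k , trans (cong (emap (hom S)) e′) e , unique
  where
  unique : ∀ {k′} → emap (hom S) (emap (hom R) (I , k′)) ≡ _ → k ≡ k′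
  unique {k′} p with emap (hom R) (I , k′) in q | src-comm (hom R) (I , k′)
  ... | _ , l′ | refl with uniqS p
  ...   | refl = uniqR q

-- First merge the images in `H` and lift both paths to `G`. Their ends lie in one fiber of `R`,
-- where `R` merges them.
≤S-trans : ∀ {G H K : Graph} → K ≤S H → H ≤S G → K ≤S G
≤S-trans {G} {H} {K} (S , syncS) (R , syncR) = S ∘R R , merging⇒synchronizer (S ∘R R) merge
  where
  image-∘ : ∀ {γ δ} → map (emap (hom R)) γ ≡ δ → map (emap (hom (S ∘R R))) γ ≡ map (emap (hom S)) δ
  image-∘ {γ} refl = map-∘ γ
  merge : Merging (S ∘R R)
  merge I₁ I₂ same with synchronizer⇒merging S syncS (vmap (hom R) I₁) (vmap (hom R) I₂) same
  ... | δ₁ , δ₂ , p₁ , p₂ , e , ends with lift R I₁ δ₁ p₁ | lift R I₂ δ₂ p₂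
  ... | γ₁ , q₁ , refl | γ₂ , q₂ , refl with synchronizer⇒merging R syncR (end G I₁ γ₁) (end G I₂ γ₂)
        (trans (sym (end-image R I₁ γ₁)) (trans ends (end-image R I₂ γ₂)))
  ... | ε₁ , ε₂ , r₁ , r₂ , e′ , ends′ =
    γ₁ ++ ε₁ , γ₂ ++ ε₂ , path-++ G I₁ γ₁ q₁ r₁ , path-++ G I₂ γ₂ q₂ r₂ ,
    image , trans (end-++ G I₁ γ₁ ε₁) (trans ends′ (sym (end-++ G I₂ γ₂ ε₂)))
    where
    Ψ = emap (hom (S ∘R R))
    image : map Ψ (γ₁ ++ ε₁) ≡ map Ψ (γ₂ ++ ε₂)
    image = begin
      map Ψ (γ₁ ++ ε₁)       ≡⟨ map-++ Ψ γ₁ ε₁ ⟩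
      map Ψ γ₁ ++ map Ψ ε₁   ≡⟨ cong₂ _++_ (trans (image-∘ refl) (trans e (sym (image-∘ refl))))
                                           (trans (image-∘ e′) (sym (image-∘ refl))) ⟩
      map Ψ γ₂ ++ map Ψ ε₂   ≡⟨ map-++ Ψ γ₂ ε₂ ⟨
      map Ψ (γ₂ ++ ε₂)       ∎
      where open ≡-Reasoning

module _ {G H : Graph} (φ : V G → V H) (φ-surj : ∀ J → ∃ λ I → φ I ≡ J)
         (β : ∀ I → Fin (deg G I) → Fin (deg H (φ I)))
         (β⁻¹ : ∀ I → Fin (deg H (φ I)) → Fin (deg G I))
         (β∘β⁻¹ : ∀ I l → β I (β⁻¹ I l) ≡ l)
         (β⁻¹∘β : ∀ I k → β⁻¹ I (β I k) ≡ k)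
         (φ-tgt : ∀ I k → tgt H (φ I) (β I k) ≡ φ (tgt G I k)) where

  resolver : RightResolver G H
  hom resolver = record
    { vmap     = φ
    ; emap     = λ (I , k) → φ I , β I k
    ; src-comm = λ _ → refl
    ; trg-comm = λ (I , k) → φ-tgt I k
    }
  emap-surj resolver (J , l) with φ-surj J
  ... | I , refl = (I , β⁻¹ I l) , cong (φ I ,_) (β∘β⁻¹ I l)
  vmap-surj resolver = φ-surj
  local-bij resolver I l = β⁻¹ I l , cong (φ I ,_) (β∘β⁻¹ I l) ,
    λ {k} e → trans (cong (β⁻¹ I) (sym (,-injectiveʳ e))) (β⁻¹∘β I k)

-- Colourings and quotients

record Quotient {n : ℕ} (_~_ : Fin n → Fin n → Set) : Set where
  field
    size      : ℕ
    class     : Fin n → Fin size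
    rep       : Fin size → Fin n
    class-rep : ∀ c → class (rep c) ≡ c
    rep-class : ∀ x → rep (class x) ~ x
    class-≡   : ∀ {x y} → x ~ y → class x ≡ class y

  -- The representatives together with the non-representative `t` are `suc size` distinct states.
  missing⇒size< : ∀ {t} → rep (class t) ≢ t → size < n
  missing⇒size< {t} rt≢t = injective⇒≤ {f = λ { zero → t ; (suc c) → rep c }} λ
    { {zero} {zero} _ → refl
    ; {zero} {suc c} e → ⊥-elim (rt≢t (trans (cong rep (trans (cong class e) (class-rep c))) (sym e)))
    ; {suc c} {zero} e → ⊥-elim (rt≢t (trans (cong rep (trans (cong class (sym e)) (class-rep c))) e))
    ; {suc c} {suc d} e → cong suc (trans (sym (class-rep c)) (trans (cong class e) (class-rep d))) }

  size< : ∀ {x y} → x ≢ y → x ~ y → size < n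
  size< {x} {y} x≢y x~y with rep (class x) ≟ x
  ... | no rx≢x = missing⇒size< rx≢x
  ... | yes rx≡x = missing⇒size< {y} λ ry≡y →
        x≢y (trans (sym rx≡x) (trans (cong rep (class-≡ x~y)) ry≡y))

-- By induction on `n`: state `zero` joins the class of a later state or forms a class of its own.
quotient : ∀ {n} {_~_ : Fin n → Fin n → Set} → IsEquivalence _~_ → Decidable₂ _~_ → Quotient _~_
quotient {zero} _ _ = record
  { size = 0 ; class = λ () ; rep = λ () ; class-rep = λ () ; rep-class = λ () ; class-≡ = λ { {()} } }
quotient {suc n} {_~_} eqv _~?_
  with quotient {n} {λ i j → suc i ~ suc j}
         (record { refl = E.refl ; sym = E.sym ; trans = E.trans }) (λ i j → suc i ~? suc j)
     | any? (λ i → suc i ~? zero)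
  where module E = IsEquivalence eqv
... | Q | yes (i , i~0) = record
  { size = size
  ; class = λ { zero → class i ; (suc j) → class j }
  ; rep = suc ∘ rep
  ; class-rep = class-rep
  ; rep-class = λ { zero → E.trans (rep-class i) i~0 ; (suc j) → rep-class j }
  ; class-≡ = λ { {zero} {zero} _ → refl
                ; {zero} {suc j} e → class-≡ (E.trans i~0 e)
                ; {suc j} {zero} e → class-≡ (E.trans e (E.sym i~0))
                ; {suc j} {suc k} e → class-≡ e }
  }
  where open Quotient Q
        module E = IsEquivalence eqv
... | Q | no none = record
  { size = suc size
  ; class = λ { zero → zero ; (suc j) → suc (class j) }
  ; rep = λ { zero → zero ; (suc c) → suc (rep c) }
  ; class-rep = λ { zero → refl ; (suc c) → cong suc (class-rep c) }
  ; rep-class = λ { zero → E.refl ; (suc j) → rep-class j }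
  ; class-≡ = λ { {zero} {zero} _ → refl
                ; {zero} {suc j} e → ⊥-elim (none (j , E.sym e))
                ; {suc j} {zero} e → ⊥-elim (none (j , e))
                ; {suc j} {suc k} e → cong suc (class-≡ e) }
  }
  where open Quotient Q
        module E = IsEquivalence eqv

iter-% : ∀ {A : Set} (f : A → A) k m .{{_ : NonZero m}} {x} → iter f m x ≡ x → iter f (k % m) x ≡ iter f k x
iter-% f k m {x} per = begin
  iter f (k % m) x                           ≡⟨ cong (iter f (k % m)) (iter-multiple f (k / m) m per) ⟨
  iter f (k % m) (iter f (k / m * m) x)      ≡⟨ iter-+ f (k % m) (k / m * m) x ⟨
  iter f (k % m + k / m * m) x               ≡⟨ cong (λ i → iter f i x) (m≡m%n+[m/n]*n k m) ⟨
  iter f k x                                 ∎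
  where open ≡-Reasoning

-- The remainder of a return time modulo the least positive one is again a return time, hence 0.
least-period : ∀ {n} (f : Fin n → Fin n) {x} → Cyc f x →
               ∃ λ l → iter f (suc l) x ≡ x × (∀ k → iter f k x ≡ x → suc l ∣ k)
least-period f {x} (k , e) with least (λ l → iter f (suc l) x ≟ x) k e
... | l , per , min = l , per , λ k e → m%n≡0⇒n∣m k (suc l) (rem≡0 k e)
  where
  rem≡0 : ∀ k → iter f k x ≡ x → k % suc l ≡ 0
  rem≡0 k e with k % suc l | m%n<n k (suc l) | iter-% f k (suc l) per
  ... | zero  | _       | _  = refl
  ... | suc i | s≤s i<l | e′ = ⊥-elim (min i i<l (trans e′ e))

out : (G : Graph) (v : V G) → Fin (deg G v)
out G v = fromℕ< (sinkFree G v)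

module _ (G : Graph) (bunches : ∀ v (k l : Fin (deg G v)) → tgt G v k ≡ tgt G v l) where

  end-follow : ∀ v γ → IsPathFrom G v γ → end G v γ ≡ iter (follower G) (length γ) v
  end-follow v [] _ = refl
  end-follow v ((_ , k) ∷ γ) (refl , p) = trans (end-follow (tgt G v k) γ p)
    (trans (cong (iter (follower G) (length γ)) (bunches v k _)) (iter-shift (follower G) (length γ) v))

  module _ (sc : StronglyConnected G) where

    follow-hits : ∀ x y → Hits (follower G) x y
    follow-hits x y with sc x y
    ... | γ , p , e = length γ , trans (sym (end-follow x γ p)) e

    follow-cyc : ∀ x → Cyc (follower G) x
    follow-cyc x with follow-hits (follower G x) x
    ... | k , e = k , trans (sym (iter-shift (follower G) k x)) e

    return-at : ∀ {v} k x → iter (follower G) k v ≡ v → iter (follower G) k x ≡ x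
    return-at {v} k x e with follow-hits v x
    ... | t , refl = begin
      iter h k (iter h t v) ≡⟨ iter-+ h k t v ⟨
      iter h (k + t) v      ≡⟨ cong (λ m → iter h m v) (+-comm k t) ⟩
      iter h (t + k) v      ≡⟨ iter-+ h t k v ⟩
      iter h t (iter h k v) ≡⟨ cong (iter h t) e ⟩
      iter h t v            ∎
      where open ≡-Reasoning
            h = follower G

    cycle-return : ∀ {v γ} x → IsCycle G v γ → iter (follower G) (length γ) x ≡ x
    cycle-return {v} {γ} x (p , e , _) = return-at (length γ) x (trans (sym (end-follow v γ p)) e)

last-edge : ∀ (G : Graph) I e γ → ∃₂ λ v k → tgt G v k ≡ end G I (e ∷ γ)
last-edge G I e []       = proj₁ e , proj₂ e , refl
last-edge G I e (e′ ∷ γ) = last-edge G (trg G e) e′ γ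

predecessor : ∀ {G} → StronglyConnected G → ∀ w → ∃₂ λ v k → tgt G v k ≡ w
predecessor {G} sc w with sc (follower G w) w
... | [] , _ , e = w , out G w , e
... | e₁ ∷ γ , _ , e with last-edge G (follower G w) e₁ γ
...   | v , k , e′ = v , k , trans e′ e

-- The gcd of the cycle lengths divides `N`. This half of `IsPeriod` passes to images, since
-- right-resolvers preserve cycles and their lengths.
PeriodDivides : Graph → ℕ → Set
PeriodDivides G N = ∀ d → (∀ I γ → IsCycle G I γ → d ∣ length γ) → d ∣ N

period-image : ∀ {G H N} → RightResolver G H → PeriodDivides G N → PeriodDivides H N
period-image R pd d dH = pd d λ I γ c →
  subst (d ∣_) (length-map _ γ) (dH _ _ (cycle-image R c))

-- Graphs as automata over a common alphabet

module Letters (G : Graph) (B : ℕ) (deg≤ : ∀ v → deg G v ≤ suc B) where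

  -- Out-degrees vary, but an automaton has one alphabet: letters beyond the out-degree act like
  -- edge 0. States of equal out-degree are clipped alike.
  clip : ∀ v → Fin (suc B) → Fin (deg G v)
  clip v a with toℕ a <? deg G v
  ... | yes lt = fromℕ< lt
  ... | no _   = out G v

  clip-≡ : ∀ {v k} a → toℕ a ≡ toℕ k → clip v a ≡ k
  clip-≡ {v} {k} a e with toℕ a <? deg G v
  ... | yes lt = toℕ-injective (trans (toℕ-fromℕ< lt) e)
  ... | no ge  = ⊥-elim (ge (subst (_< deg G v) (sym e) (toℕ<n k)))

  clip-toℕ : ∀ {v w} a → deg G v ≡ deg G w → toℕ (clip v a) ≡ toℕ (clip w a)
  clip-toℕ {v} {w} a e with toℕ a <? deg G v | toℕ a <? deg G w
  ... | yes p | yes q = trans (toℕ-fromℕ< p) (sym (toℕ-fromℕ< q))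
  ... | yes p | no q  = ⊥-elim (q (subst (toℕ a <_) e p))
  ... | no p  | yes q = ⊥-elim (p (subst (toℕ a <_) (sym e) q))
  ... | no _  | no _  = trans (toℕ-fromℕ< (sinkFree G v)) (sym (toℕ-fromℕ< (sinkFree G w)))

  letter : ∀ {v} → Fin (deg G v) → Fin (suc B)
  letter {v} k = fromℕ< (<-≤-trans (toℕ<n k) (deg≤ v))

  toℕ-letter : ∀ {v} (k : Fin (deg G v)) → toℕ (letter k) ≡ toℕ k
  toℕ-letter k = toℕ-fromℕ< _

  δ : V G → Fin (suc B) → V G
  δ v a = tgt G v (clip v a)

  open Automaton δ public

  δ-letter : ∀ {v} {l : Fin (deg G v)} a → toℕ a ≡ toℕ l → δ v a ≡ tgt G v l
  δ-letter {v} a e = cong (tgt G v) (clip-≡ a e)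

  run-connected : StronglyConnected G → ∀ x y → ∃ λ w → run x w ≡ y
  run-connected sc x y = let γ , p , e = sc x y in map label γ , trans (run-letters x γ p) e
    where
    label : E G → Fin (suc B)
    label (_ , k) = letter k

    run-letters : ∀ x γ → IsPathFrom G x γ → run x (map label γ) ≡ end G x γ
    run-letters x [] _ = refl
    run-letters x ((_ , k) ∷ γ) (refl , p) =
      trans (cong (λ y → run y (map label γ)) (δ-letter (letter k) (toℕ-letter k))) (run-letters (tgt G x k) γ p)

  path : V G → List (Fin (suc B)) → List (E G)
  path x []      = []
  path x (a ∷ w) = (x , clip x a) ∷ path (δ x a) w

  path-valid : ∀ x w → IsPathFrom G x (path x w)
  path-valid x []      = tt
  path-valid x (a ∷ w) = refl , path-valid (δ x a) w

  end-path : ∀ x w → end G x (path x w) ≡ run x w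
  end-path x []      = refl
  end-path x (a ∷ w) = end-path (δ x a) w

edge-≡ : ∀ {H : Graph} {I J} {k : Fin (deg H I)} {l : Fin (deg H J)} → I ≡ J → toℕ k ≡ toℕ l → (I , k) ≡ (J , l)
edge-≡ refl e = cong (_ ,_) (toℕ-injective e)

-- The edges are merely renumbered: `κ v` changes places with edge 0, which is the one that the
-- letter `zero` follows.
recolour : (G : Graph) → (∀ v → Fin (deg G v)) → Graph
recolour G κ = record G { tgt = λ v k → tgt G v (transpose (out G v) (κ v) k) }

recolour-resolver : ∀ G κ → RightResolver G (recolour G κ)
recolour-resolver G κ = resolver id (λ v → v , refl)
  (λ v → transpose (κ v) (out G v)) (λ v → transpose (out G v) (κ v))
  (λ v _ → transpose-inverse (κ v) (out G v)) (λ v _ → transpose-inverse (out G v) (κ v))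
  (λ v _ → cong (tgt G v) (transpose-inverse (out G v) (κ v)))

recolour-≤S : ∀ G κ → recolour G κ ≤S G
recolour-≤S G κ = recolour-resolver G κ ,
  merging⇒synchronizer (recolour-resolver G κ) (injective⇒merging (recolour-resolver G κ) id)

follower-recolour : ∀ G κ v → follower (recolour G κ) v ≡ tgt G v (κ v)
follower-recolour G κ v = cong (tgt G v) transpose-out
  where
  transpose-out : transpose (out G v) (κ v) (out G v) ≡ κ v
  transpose-out rewrite dec-true (out G v ≟ out G v) refl = refl

module Colouring (O : Graph) (next : V O → V O) (tgt-O : ∀ j k → tgt O j k ≡ next j)
                 (next-inj : ∀ {i j} → next i ≡ next j → i ≡ j)
                 (N : ℕ) (next-period : ∀ j k → iter next k j ≡ j → N ∣ k) where

  iter-next-inj : ∀ k {i j} → iter next k i ≡ iter next k j → i ≡ j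
  iter-next-inj zero e = e
  iter-next-inj (suc k) e = iter-next-inj k (next-inj e)

  -- The state part of a right-resolver onto `O`. As all edges out of a state of `O` share their
  -- target, any bijections of out-edges complete it.
  record Phase (G : Graph) : Set where
    field
      phase      : V G → V O
      phase-surj : ∀ j → ∃ λ v → phase v ≡ j
      phase-deg  : ∀ v → deg G v ≡ deg O (phase v)
      phase-tgt  : ∀ v k → phase (tgt G v k) ≡ next (phase v)

    same-deg : ∀ {v w} → phase v ≡ phase w → deg G v ≡ deg G w
    same-deg {v} {w} e = trans (phase-deg v) (trans (cong (deg O) e) (sym (phase-deg w)))

    phase-end : ∀ v γ → IsPathFrom G v γ → phase (end G v γ) ≡ iter next (length γ) (phase v)
    phase-end v [] _ = refl
    phase-end v ((_ , k) ∷ γ) (refl , p) = trans (phase-end (tgt G v k) γ p)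
      (trans (cong (iter next (length γ)) (phase-tgt v k)) (iter-shift next (length γ) (phase v)))

    phase-resolver : RightResolver G O
    phase-resolver = resolver phase phase-surj
      (λ v → cast (phase-deg v)) (λ v → cast (sym (phase-deg v)))
      (λ v → cast-involutive (phase-deg v) (sym (phase-deg v)))
      (λ v → cast-involutive (sym (phase-deg v)) (phase-deg v))
      (λ v k → trans (tgt-O (phase v) _) (sym (phase-tgt v k)))

  recolour-phase : ∀ {G κ} → Phase G → Phase (recolour G κ)
  recolour-phase ph = record
    { phase = phase ; phase-surj = phase-surj ; phase-deg = phase-deg ; phase-tgt = λ v k → phase-tgt v _ }
    where open Phase ph

  Reducible : Graph → Set
  Reducible G = ∃ λ H → nV H < nV G × StronglyConnected H × Phase H × PeriodDivides H N × H ≤S G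

  module StableQuotient (G : Graph) (ph : Phase G) (B : ℕ) (deg≤ : ∀ v → deg G v ≤ suc B) where
    open Phase ph
    open Letters G B deg≤

    -- Each letter advances the phase by `next`, which is injective, so equal phases at the end were
    -- equal at the start.
    sync-phase : ∀ {x y} → Sync x y → phase x ≡ phase y
    sync-phase {x} {y} (w , e) = iter-next-inj (length w) (begin
      iter next (length w) (phase x)  ≡⟨ phase-run x w ⟨
      phase (run x w)                 ≡⟨ cong phase e ⟩
      phase (run y w)                 ≡⟨ phase-run y w ⟩
      iter next (length w) (phase y)  ∎)
      where
      open ≡-Reasoning
      phase-run : ∀ x w → phase (run x w) ≡ iter next (length w) (phase x)
      phase-run x [] = refl
      phase-run x (a ∷ w) = trans (phase-run (δ x a) w)
        (trans (cong (iter next (length w)) (phase-tgt x _)) (iter-shift next (length w) (phase x)))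

    stable-classes : Quotient StablePair
    stable-classes = quotient (record { refl = stable-refl ; sym = stable-sym ; trans = stable-trans }) stable?

    open Quotient stable-classes

    H : Graph
    H = record
      { nV       = size
      ; deg      = λ c → deg G (rep c)
      ; tgt      = λ c k → class (tgt G (rep c) k)
      ; sinkFree = λ c → sinkFree G (rep c)
      }

    phase-rep : ∀ v → phase (rep (class v)) ≡ phase v
    phase-rep v = sync-phase (rep-class v [])

    deg-rep : ∀ v → deg G v ≡ deg G (rep (class v))
    deg-rep v = same-deg (sym (phase-rep v))

    tgt-stable : ∀ {v w} {k : Fin (deg G v)} {l : Fin (deg G w)} →
                 StablePair v w → toℕ k ≡ toℕ l → class (tgt G v k) ≡ class (tgt G w l)
    tgt-stable {k = k} {l} st e = class-≡ (subst₂ StablePair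
      (δ-letter (letter k) (toℕ-letter k)) (δ-letter (letter k) (trans (toℕ-letter k) e))
      (stable-step (letter k) st))

    quotient-resolver : RightResolver G H
    quotient-resolver = resolver class (λ c → rep c , class-rep c)
      (λ v → cast (deg-rep v)) (λ v → cast (sym (deg-rep v)))
      (λ v → cast-involutive (deg-rep v) (sym (deg-rep v)))
      (λ v → cast-involutive (sym (deg-rep v)) (deg-rep v))
      (λ v k → tgt-stable (rep-class v) (toℕ-cast (deg-rep v) k))

    quotient-merging : Merging quotient-resolver
    quotient-merging x y same = merge (stable-trans (stable-sym (rep-class x))
        (subst (λ c → StablePair (rep c) y) (sym same) (rep-class y)) [])
      where
      Φ = emap (hom quotient-resolver)

      -- Stability is a congruence and equal phases give equal out-degrees, so at each letter both
      -- paths use the same edge of `H`.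
      images : ∀ {x y} w → phase x ≡ phase y → class x ≡ class y → map Φ (path x w) ≡ map Φ (path y w)
      images [] _ _ = refl
      images {x} {y} (a ∷ w) ex ec = cong₂ _∷_
        (edge-≡ {H} ec (trans (toℕ-cast (deg-rep x) _)
          (trans (clip-toℕ a (same-deg ex)) (sym (toℕ-cast (deg-rep y) _)))))
        (images w (trans (phase-tgt x _) (trans (cong next ex) (sym (phase-tgt y _))))
          (class-≡ (stable-step a stable-xy)))
        where
        stable-xy : StablePair x y
        stable-xy = stable-trans (stable-sym (rep-class x))
          (subst (λ c → StablePair (rep c) y) (sym ec) (rep-class y))

      merge : Sync x y → ∃₂ λ γ₁ γ₂ → IsPathFrom G x γ₁ × IsPathFrom G y γ₂ ×
              map Φ γ₁ ≡ map Φ γ₂ × end G x γ₁ ≡ end G y γ₂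
      merge (w , e) = path x w , path y w , path-valid x w , path-valid y w ,
        images w (sync-phase (w , e)) same , trans (end-path x w) (trans e (sym (end-path y w)))

    quotient-phase : Phase H
    quotient-phase = record
      { phase      = λ c → phase (rep c)
      ; phase-surj = λ j → let v , e = phase-surj j in class v , trans (phase-rep v) e
      ; phase-deg  = λ c → phase-deg (rep c)
      ; phase-tgt  = λ c k → trans (phase-rep (tgt G (rep c) k)) (phase-tgt (rep c) k)
      }

    reduce : StronglyConnected G → PeriodDivides G N → (∃₂ λ x y → x ≢ y × StablePair x y) → Reducible G
    reduce sc pd (x , y , x≢y , st) = H , size< x≢y st , connected-image quotient-resolver sc ,
      quotient-phase , period-image quotient-resolver pd ,
      quotient-resolver , merging⇒synchronizer quotient-resolver quotient-merging

  Twins Fork : Graph → Set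
  Twins G = ∃₂ λ c e → c ≢ e × (∀ k l → tgt G c k ≡ tgt G e l)
  Fork G = ∃ λ v → ∃₂ λ k l → tgt G v k ≢ tgt G v l

  -- Without a fork, `G` is one cycle of bunches whose length divides `N`. A path between states of
  -- equal phase has length divisible by `N`, so it returns to its start.
  fork : ∀ {G} → StronglyConnected G → (ph : Phase G) → PeriodDivides G N →
         ∀ {x y} → Phase.phase ph x ≡ Phase.phase ph y → x ≢ y → Fork G
  fork {G} sc ph pd {x} {y} same x≢y with any? (λ v → any? (λ k → any? (λ l → ¬? (tgt G v k ≟ tgt G v l))))
  ... | yes f = f
  ... | no none with sc x y
  ... | γ , p , refl = ⊥-elim (x≢y (sym (trans (end-follow G bunches x γ p) returns)))
    where
    open Phase ph
    h = follower G

    bunches : ∀ v k l → tgt G v k ≡ tgt G v l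
    bunches v k l = decidable-stable (tgt G v k ≟ tgt G v l) λ ne → none (v , k , l , ne)

    returns : iter h (length γ) x ≡ x
    returns with least-period h (follow-cyc G bunches sc x)
    ... | l , per , divs with ∣-trans (pd (suc l) λ v δ c → divs (length δ) (cycle-return G bunches sc x c))
                              (next-period (phase x) (length γ) (trans (sym (phase-end x γ p)) (sym same)))
    ...   | divides q e = trans (cong (λ k → iter h k x) e) (iter-multiple h q (suc l) per)

  no-twins : ∀ {G} → ¬ Twins G → ∀ {c e r} → c ≢ e → (∃ λ k → tgt G c k ≡ r) → (∃ λ l → tgt G e l ≡ r) →
             (∃ λ g → (∃ λ k → tgt G c k ≡ g) × g ≢ r) ⊎ (∃ λ g → (∃ λ l → tgt G e l ≡ g) × g ≢ r)
  no-twins {G} nt {c} {e} {r} c≢e _ _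
    with any? (λ k → ¬? (tgt G c k ≟ r)) | any? (λ l → ¬? (tgt G e l ≟ r))
  ... | yes (k , ne) | _ = inj₁ (_ , (k , refl) , ne)
  ... | no _ | yes (l , ne) = inj₂ (_ , (l , refl) , ne)
  ... | no allc | no alle = ⊥-elim (nt (c , e , c≢e , λ k l →
        trans (decidable-stable (tgt G c k ≟ r) λ ne → allc (k , ne))
              (sym (decidable-stable (tgt G e l ≟ r) λ ne → alle (l , ne)))))

  reducible : ∀ {G} → StronglyConnected G → (ph : Phase G) → PeriodDivides G N →
              ∀ {x y} → Phase.phase ph x ≡ Phase.phase ph y → x ≢ y → Reducible G
  reducible {G} sc ph pd {x} {y} same x≢y = by-twins (any? λ c → any? λ e →
      ¬? (c ≟ e) ×-dec all? λ k → all? λ l → tgt G c k ≟ tgt G e l)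
    where
    widest = argmax x (deg G)
    -- With `suc B` letters the alphabet has a letter `zero` by its form; the spare last letter is
    -- clipped.
    B = deg G (proj₁ widest)

    deg≤ : ∀ v → deg G v ≤ suc B
    deg≤ v = m≤n⇒m≤1+n (proj₂ widest v)

    Edge : V G → V G → Set
    Edge v w = ∃ λ k → tgt G v k ≡ w

    by-twins : Dec (Twins G) → Reducible G
    by-twins (yes (c , e , c≢e , twins)) = StableQuotient.reduce G ph B deg≤ sc pd (c , e , c≢e , stable)
      where
      open Letters G B deg≤
      stable : StablePair c e
      -- Any letter merges twins, whichever of their edges it selects.
      stable [] = zero ∷ [] , twins _ _
      stable (a ∷ u) = [] , cong (λ v → run v u) (twins _ _)
    by-twins (no nt) with ChoiceFunction.good-choice Edge
        (λ w → let v , k , e = predecessor sc w in v , k , e)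
        (let v , k , l , ne = fork sc ph pd same x≢y in v , _ , _ , (k , refl) , (l , refl) , ne)
        (no-twins {G} nt) x (λ v → out G v , refl)
    ... | f , valid , good = reduced
      where
      κ : ∀ v → Fin (deg G v)
      κ v = proj₁ (valid v)

      G′ = recolour G κ
      sc′ = connected-image (recolour-resolver G κ) sc
      open Letters G′ B deg≤

      zero-acts : ∀ v → δ v zero ≡ f v
      zero-acts v = trans (δ-letter zero (sym (toℕ-fromℕ< (sinkFree G v))))
        (trans (follower-recolour G κ v) (proj₂ (valid v)))

      reduced : Reducible G
      reduced = let H , smaller , scH , phH , pdH , H≤G′ = StableQuotient.reduce G′ (recolour-phase ph) B deg≤
                      sc′ (period-image (recolour-resolver G κ) pd)
                      (good⇒stable (run-connected sc′) zero zero-acts x good)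
                in H , smaller , scH , phH , pdH , ≤S-trans H≤G′ (recolour-≤S G κ)

  -- Induction on the number of states; when every fiber is a single state, `phase-resolver`
  -- synchronizes trivially.
  road-colouring : ∀ fuel {G} → nV G < fuel → StronglyConnected G → Phase G → PeriodDivides G N → O ≤S G
  road-colouring (suc fuel) {G} (s≤s n≤) sc ph pd = by-fibers
    (any? λ x → any? λ y → (phase x ≟ phase y) ×-dec ¬? (x ≟ y))
    where
    open Phase ph
    by-fibers : Dec (∃₂ λ x y → phase x ≡ phase y × x ≢ y) → O ≤S G
    by-fibers (yes (x , y , same , x≢y)) =
      let H , smaller , scH , phH , pdH , H≤G = reducible sc ph pd same x≢y
      in ≤S-trans (road-colouring fuel (<-≤-trans smaller n≤) scH phH pdH) H≤G
    by-fibers (no none) = phase-resolver , merging⇒synchronizer phase-resolver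
      (injective⇒merging phase-resolver λ {x} {y} e → decidable-stable (x ≟ y) λ ne → none (x , y , e , ne))

-- Phases modulo the period

suc-%-% : ∀ k n .{{_ : NonZero n}} → suc (k % n) % n ≡ suc k % n
suc-%-% k n = trans (sym ([m+kn]%n≡m%n (suc (k % n)) (k / n) n))
                    (cong (λ m → suc m % n) (sym (m≡m%n+[m/n]*n k n)))

toℕ-cyc : ∀ {n} .{{_ : NonZero n}} (i : Fin n) → toℕ (cyc i) ≡ suc (toℕ i) % n
toℕ-cyc {suc n} i with n ℕ.≟ toℕ i
... | yes e = sym (trans (cong (λ m → suc m % suc n) (sym e)) (n%n≡0 (suc n)))
... | no ne = trans (cong suc (toℕ-lower₁ i ne))
                    (sym (m<n⇒m%n≡m (s≤s (≤∧≢⇒< (≤-pred (toℕ<n i)) (ne ∘ sym)))))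

toℕ-iter-cyc : ∀ {n} .{{_ : NonZero n}} k (i : Fin n) → toℕ (iter cyc k i) ≡ (k + toℕ i) % n
toℕ-iter-cyc         zero    i = sym (m<n⇒m%n≡m (toℕ<n i))
toℕ-iter-cyc {n = n} (suc k) i = trans (toℕ-cyc (iter cyc k i))
  (trans (cong (λ m → suc m % n) (toℕ-iter-cyc k i)) (suc-%-% (k + toℕ i) n))

cyc-period : ∀ {n} .{{_ : NonZero n}} (i : Fin n) k → iter cyc k i ≡ i → n ∣ k
cyc-period {n} i k e = divides ((k + toℕ i) / n) (+-cancelʳ-≡ (toℕ i) k _ (begin
  k + toℕ i                                       ≡⟨ m≡m%n+[m/n]*n (k + toℕ i) n ⟩
  (k + toℕ i) % n + (k + toℕ i) / n * n           ≡⟨ cong (_+ (k + toℕ i) / n * n) (trans (sym (toℕ-iter-cyc k i)) (cong toℕ e)) ⟩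
  toℕ i + (k + toℕ i) / n * n                     ≡⟨ +-comm (toℕ i) _ ⟩
  (k + toℕ i) / n * n + toℕ i                     ∎))
  where open ≡-Reasoning

cyc-return : ∀ {n} .{{_ : NonZero n}} (i : Fin n) → iter cyc n i ≡ i
cyc-return {n} i = toℕ-injective (trans (toℕ-iter-cyc n i) (trans (cong (_% n) (+-comm n (toℕ i)))
  (trans (%-remove-+ʳ (toℕ i) (divides 1 (sym (*-identityˡ n)))) (m<n⇒m%n≡m (toℕ<n i)))))

cyc-injective : ∀ {n} {i j : Fin n} → cyc i ≡ cyc j → i ≡ j
cyc-injective {suc n} {i} {j} e = begin
  i                     ≡⟨ cyc-return i ⟨
  iter cyc (suc n) i    ≡⟨ iter-shift cyc n i ⟨
  iter cyc n (cyc i)    ≡⟨ cong (iter cyc n) e ⟩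
  iter cyc n (cyc j)    ≡⟨ iter-shift cyc n j ⟩
  iter cyc (suc n) j    ≡⟨ cyc-return j ⟩
  j                     ∎
  where open ≡-Reasoning

resolver-deg : ∀ {G H} (R : RightResolver G H) I → deg G I ≡ deg H (vmap (hom R) I)
resolver-deg {G} {H} R I = cantor-schröder-bernstein {f = to} {g = from} to-inj from-inj
  where
  ∂I = vmap (hom R) I

  image : ∀ k → ∃ λ (l : Fin (deg H ∂I)) → emap (hom R) (I , k) ≡ (∂I , l)
  image k with emap (hom R) (I , k) | src-comm (hom R) (I , k)
  ... | _ , l | refl = l , refl

  to : Fin (deg G I) → Fin (deg H ∂I)
  to k = proj₁ (image k)

  to-inj : ∀ {k k′} → to k ≡ to k′ → k ≡ k′
  to-inj {k} {k′} e with local-bij R I (to k)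
  ... | _ , _ , unique = trans (sym (unique (proj₂ (image k))))
                               (unique (trans (proj₂ (image k′)) (cong (∂I ,_) (sym e))))

  from : Fin (deg H ∂I) → Fin (deg G I)
  from l = proj₁ (local-bij R I l)

  from-inj : ∀ {l l′} → from l ≡ from l′ → l ≡ l′
  from-inj {l} {l′} e = ,-injectiveʳ (trans (sym (proj₁ (proj₂ (local-bij R I l))))
    (trans (cong (λ k → emap (hom R) (I , k)) e) (proj₁ (proj₂ (local-bij R I l′)))))

follow-path : ∀ (G : Graph) v k → ∃ λ γ → IsPathFrom G v γ × length γ ≡ k × end G v γ ≡ iter (follower G) k v
follow-path G v zero = [] , tt , refl , refl
follow-path G v (suc k) with follow-path G (follower G v) k
... | γ , p , l , e = (v , out G v) ∷ γ , (refl , p) , cong suc l , trans e (iter-shift (follower G) k v)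

walk≡iter : ∀ G v k → walk G v k ≡ iter (follower G) k v
walk≡iter G v zero    = refl
walk≡iter G v (suc k) = cong (follower G) (walk≡iter G v k)

-- The length and period of a cycle of bunches

module _ (M : Graph) (cb : CycleOfBunches M) (I₀ : V M) where

  private
    h = follower M
    sc = proj₁ cb
    bunches = proj₂ cb

    abstract
      period : ∃ λ l → iter h (suc l) I₀ ≡ I₀ × (∀ k → iter h k I₀ ≡ I₀ → suc l ∣ k)
      period = least-period h (follow-cyc M bunches sc I₀)

    p : ℕ
    p = suc (proj₁ period)

    returns : iter h p I₀ ≡ I₀
    returns = proj₁ (proj₂ period)

    divs : ∀ k → iter h k I₀ ≡ I₀ → p ∣ k
    divs = proj₂ (proj₂ period)

    -- A repetition yields the return time `j ∸ i`, positive and below the least one.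
    no-early-return : ∀ i j → j < p → i < j → iter h i I₀ ≢ iter h j I₀
    no-early-return i j j<p i<j e = <⇒≱ (<-≤-trans (s≤s (m∸n≤m j i)) j<p)
      (∣⇒≤ {{≢-nonZero (m>n⇒m∸n≢0 i<j)}} (divs (j ∸ i)
        (return-at M bunches sc (j ∸ i) I₀ (trans (iter-∸ h I₀ (<⇒≤ i<j)) (sym e)))))

    state : Fin p → V M
    state i = iter h (toℕ i) I₀

    state-inj : ∀ {i j} → state i ≡ state j → i ≡ j
    state-inj {i} {j} e with <-cmp (toℕ i) (toℕ j)
    ... | tri< i<j _ _ = ⊥-elim (no-early-return _ _ (toℕ<n j) i<j e)
    ... | tri≈ _ i≡j _ = toℕ-injective i≡j
    ... | tri> _ _ j<i = ⊥-elim (no-early-return _ _ (toℕ<n i) j<i (sym e))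

    index : V M → Fin p
    index J = fromℕ< (m%n<n (proj₁ (follow-hits M bunches sc I₀ J)) p)

    state-index : ∀ J → state (index J) ≡ J
    state-index J = let k , e = follow-hits M bunches sc I₀ J in
      trans (cong (λ m → iter h m I₀) (toℕ-fromℕ< (m%n<n k p))) (trans (iter-% h k p returns) e)

    index-inj : ∀ {J K} → index J ≡ index K → J ≡ K
    index-inj {J} {K} e = trans (sym (state-index J)) (trans (cong state e) (state-index K))

    p≡nV : p ≡ nV M
    p≡nV = cantor-schröder-bernstein {f = state} {g = index} state-inj index-inj

  bunches-return : iter h (nV M) I₀ ≡ I₀
  bunches-return = subst (λ k → iter h k I₀ ≡ I₀) p≡nV returns

  bunches-period : ∀ {d} → IsPeriod M d → d ≡ nV M
  bunches-period {d} (d∣ , d-max) = trans (∣-antisym d∣p p∣d) p≡nV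
    where
    p∣d : p ∣ d
    p∣d = d-max p λ v γ c → divs (length γ) (cycle-return M bunches sc I₀ c)
    d∣p : d ∣ p
    d∣p with follow-path M I₀ p
    ... | γ , path , l , e = subst (d ∣_) l (d∣ I₀ γ (path , trans e returns , ≤-trans (s≤s z≤n) (≤-reflexive (sym l))))

-- The phase map of a strongly connected graph

module _ {G M : Graph} (sc : StronglyConnected G) (R : RightResolver G M) (cb : CycleOfBunches M)
         (I₀ : V M) (q : ℕ) (period : IsPeriod G (nV M * q)) where

  private
    N = nV M * q

    -- Phases are measured from a state over `I₀`, to match the labelling of `O` by `walk M I₀`.
    g₀ : V G
    g₀ = proj₁ (vmap-surj R I₀)

    closed : ∀ {v γ} → IsPathFrom G v γ → end G v γ ≡ v → N ∣ length γ
    closed {γ = []} _ _ = N ∣0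
    closed {v} {e ∷ γ} p c = proj₁ period v (e ∷ γ) (p , c , s≤s z≤n)

    instance
      -- An edge out of `g₀` and a path back form a cycle of positive length, which 0 cannot divide.
      N≢0 : NonZero N
      N≢0 = ≢-nonZero λ N≡0 → let γ , p , c = sc (follower G g₀) g₀ in
        1+n≢0 (0∣⇒≡0 (subst (_∣ suc (length γ)) N≡0 (closed {γ = (g₀ , out G g₀) ∷ γ} (refl , p) c)))

    path : ∀ v → ∃ λ γ → IsPathFrom G g₀ γ × end G g₀ γ ≡ v
    path v = sc g₀ v

    dist : V G → ℕ
    dist v = length (proj₁ (path v))

    -- Closing both paths with the same way back `ρ` to `g₀` gives two lengths divisible by `N`.
    dist-% : ∀ {v} γ → IsPathFrom G g₀ γ → end G g₀ γ ≡ v → length γ % N ≡ dist v % N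
    dist-% {v} γ p refl with path v | sc v g₀
    ... | δ , q , e | ρ , r , e′ = begin
      length γ % N                              ≡⟨ %-remove-+ʳ (length γ) (back δ q e) ⟨
      (length γ + (length δ + length ρ)) % N    ≡⟨ cong (_% N) (swap (length γ) (length δ) (length ρ)) ⟩
      (length δ + (length γ + length ρ)) % N    ≡⟨ %-remove-+ʳ (length δ) (back γ p refl) ⟩
      length δ % N                              ∎
      where
      open ≡-Reasoning
      swap : ∀ a b c → a + (b + c) ≡ b + (a + c)
      swap a b c = trans (sym (+-assoc a b c)) (trans (cong (_+ c) (+-comm a b)) (+-assoc b a c))
      back : ∀ γ → IsPathFrom G g₀ γ → end G g₀ γ ≡ v → N ∣ length γ + length ρ
      back γ p e = subst (N ∣_) (length-++ γ) (closed
        (path-++ G g₀ γ p (subst (λ w → IsPathFrom G w ρ) (sym e) r))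
        (trans (end-++ G g₀ γ ρ) (trans (cong (λ w → end G w ρ) e) e′)))

    phase : V G → Fin N
    phase v = fromℕ< (m%n<n (dist v) N)

    toℕ-phase : ∀ v → toℕ (phase v) ≡ dist v % N
    toℕ-phase v = toℕ-fromℕ< (m%n<n (dist v) N)

    phase-surj : ∀ j → ∃ λ v → phase v ≡ j
    phase-surj j with follow-path G g₀ (toℕ j)
    ... | γ , p , l , _ = end G g₀ γ , toℕ-injective (begin
      toℕ (phase (end G g₀ γ))  ≡⟨ toℕ-phase (end G g₀ γ) ⟩
      dist (end G g₀ γ) % N     ≡⟨ dist-% γ p refl ⟨
      length γ % N              ≡⟨ cong (_% N) l ⟩
      toℕ j % N                 ≡⟨ m<n⇒m%n≡m (toℕ<n j) ⟩
      toℕ j                     ∎)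
      where open ≡-Reasoning

    phase-tgt : ∀ v k → phase (tgt G v k) ≡ cyc (phase v)
    phase-tgt v k = toℕ-injective (begin
      toℕ (phase (tgt G v k))           ≡⟨ toℕ-phase (tgt G v k) ⟩
      dist (tgt G v k) % N              ≡⟨ dist-% (γ ++ (v , k) ∷ []) (path-++ G g₀ γ p (sym e , tt)) (end-++ G g₀ γ _) ⟨
      length (γ ++ (v , k) ∷ []) % N    ≡⟨ cong (_% N) (trans (length-++ γ) (+-comm (length γ) 1)) ⟩
      suc (dist v) % N                  ≡⟨ suc-%-% (dist v) N ⟨
      suc (dist v % N) % N              ≡⟨ cong (λ m → suc m % N) (toℕ-phase v) ⟨
      suc (toℕ (phase v)) % N           ≡⟨ toℕ-cyc (phase v) ⟨
      toℕ (cyc (phase v))               ∎)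
      where
      open ≡-Reasoning
      γ = proj₁ (path v)
      p = proj₁ (proj₂ (path v))
      e = proj₂ (proj₂ (path v))

    -- A path from `g₀` to `v` maps to a path of the same length from `I₀`, where only the length
    -- matters. It may be reduced modulo `N`, a multiple of the length of the cycle `M`. Out-degrees
    -- in `G` thus match those of `O`.
    state-phase : ∀ v → vmap (hom R) v ≡ walk M I₀ (toℕ (phase v))
    state-phase v = begin
      vmap (hom R) v                    ≡⟨ cong (vmap (hom R)) e ⟨
      vmap (hom R) (end G g₀ γ)         ≡⟨ end-image R g₀ γ ⟨
      end M (vmap (hom R) g₀) (map (emap (hom R)) γ)
                                        ≡⟨ end-follow M (proj₂ cb) _ (map (emap (hom R)) γ) (path-image R g₀ γ p) ⟩
      iter h (length (map (emap (hom R)) γ)) (vmap (hom R) g₀)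
                                        ≡⟨ cong₂ (iter h) (length-map _ γ) (proj₂ (vmap-surj R I₀)) ⟩
      iter h (length γ) I₀              ≡⟨ iter-% h (length γ) N N-return ⟨
      iter h (length γ % N) I₀          ≡⟨ cong (λ m → iter h m I₀) (sym (toℕ-phase v)) ⟩
      iter h (toℕ (phase v)) I₀         ≡⟨ walk≡iter M I₀ (toℕ (phase v)) ⟨
      walk M I₀ (toℕ (phase v))         ∎
      where
      open ≡-Reasoning
      h = follower M
      γ = proj₁ (path v)
      p = proj₁ (proj₂ (path v))
      e = proj₂ (proj₂ (path v))
      N-return : iter h N I₀ ≡ I₀
      N-return = subst (λ k → iter h k I₀ ≡ I₀) (*-comm q (nV M))
        (iter-multiple h q (nV M) (bunches-return M cb I₀))

  O-≤S : O M I₀ q ≤S G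
  O-≤S = road-colouring (suc (nV G)) ≤-refl sc
    (record
      { phase      = phase
      ; phase-surj = phase-surj
      ; phase-deg  = λ v → trans (resolver-deg R v) (cong (deg M) (state-phase v))
      ; phase-tgt  = phase-tgt
      })
    (proj₂ period)
    where open Colouring (O M I₀ q) cyc (λ _ _ → refl) cyc-injective N (λ j k → cyc-period j k)

theorem4p3 : (G M : Graph) → StronglyConnected G →
    M ≤R G → IsRMinimal M → CycleOfBunches M →
    (dG dM q : ℕ) → IsPeriod G dG → IsPeriod M dM → dG ≡ q * dM →
    (I₀ : V M) → O M I₀ q ≤S G
theorem4p3 G M sc R _ cb dG dM q perG perM dG≡ I₀ = O-≤S sc R cb I₀ q
  -- The period of `M` is its number of states, so the period of `G` is the number of states of
  -- `O M I₀ q`.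
  (subst (IsPeriod G) (trans dG≡ (trans (cong (q *_) (bunches-period M cb I₀ perM)) (*-comm q (nV M)))) perG)
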